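{- Let $m\ge1$ be an integer. For $k\ge0$ let $f_{ -m+k}$ (resp. $g_{ -m+k}$) be the generating function, with respect to the size (marked by $z$), of grand zigzag knight's paths staying above the line $y=-m$ and ending at altitude $-m+k$ with an up-step $N$ or $E$ (resp. with a down-step $\bar N$ or $\bar E$), the empty path being counted in $f_0$. Put $F(u)=\sum_{k\ge0}f_{ -m+k}u^k$ and $G(u)=\sum_{k\ge0}g_{ -m+k}u^k$, and let $$r=\frac{1-z^4-z^2-\sqrt{z^8-2z^6-z^4-2z^2+1}}{2z^3},\qquad s=\frac{1-z^4-z^2+\sqrt{z^8-2z^6-z^4-2z^2+1}}{2z^3}.$$ Then $$F(u)=-\frac{u\left(u^m(1+z^2u+zu^2)-r^{m-1}z(u+z)(z+rz^2+r^2)\right)}{z^3(u-r)(u-s)},$$ $$G(u)=\frac{r^{m-1}(z+r^2+z^2r)-zu^{m-1}(1+zu)(1+z^2u+zu^2)}{z^3(u-r)(u-s)}.$$ Setting $H(u):=F(u)+G(u)$, the generating function for the total number of grand zigzag knight's paths staying above $y=-m$ with respect to the size is $$H(1)=\frac{zr^{m-1}+z^2r^m+r^{m+1}-z^2-z-1}{z^2+z-1}.$$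
   Context: A grand zigzag knight's path is a lattice path in $\mathbb{Z}^2$ starting at the origin, made of steps $N=(1,2)$, $\bar N=(1,-2)$, $E=(2,1)$, $\bar E=(2,-1)$, such that the vertical components of two consecutive steps never have the same direction (up-steps $N,E$ and down-steps $\bar N,\bar E$ alternate); the empty path is allowed. The size is the $x$-coordinate and the altitude the $y$-coordinate of the last point. A path stays above the line $y=-m$ if all its points have $y$-coordinate $\ge -m$ (points on the line are allowed). The square root is the power series branch with value $1$ at $z=0$, so $r$ is a power series in $z$ with leading term $z^3$ and $s=1/r$. -}

module Defs where

open import Level using (Level; 0ℓ; _⊔_)
open import Algebra.Bundles using (RawRing; CommutativeMonoid)
import Algebra.Definitions.RawSemiring as RawSemiringDefinitions
open import Algebra.Properties.Monoid.Sum using (sum-init-last)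
open import Algebra.Properties.CommutativeMonoid.Sum using (sum-cong-≗)
open import Data.Fin.Base using (Fin; toℕ)
open import Data.Fin.Properties using (toℕ-inject₁; toℕ-fromℕ; toℕ<n)
open import Data.Integer.Base as ℤ using (ℤ; +_)
import Data.Integer.Properties as ℤ
open import Data.List.Base using (List; []; _∷_; _++_; map; filter; foldr; inits; last; length)
open import Data.List.Membership.Propositional using (_∈_)
open import Data.List.Membership.Propositional.Properties using (∈-map⁺; ∈-map⁻; ∈-++⁺ˡ; ∈-++⁺ʳ; ∈-++⁻)
import Data.List.Properties as List
open import Data.List.Relation.Unary.All using (All; all?)
open import Data.List.Relation.Unary.Any using (here; there)
open import Data.List.Relation.Unary.AllPairs using ([]; _∷_)
import Data.List.Relation.Unary.All as All
open import Data.List.Relation.Unary.Linked using (Linked; linked?)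
open import Data.List.Relation.Unary.Unique.Propositional using (Unique)
import Data.List.Relation.Unary.Unique.Propositional.Properties as Unique
import Data.Maybe.Relation.Unary.All as MaybeAll
import Data.Maybe.Relation.Unary.Any as MaybeAny
open import Data.Nat.Base as ℕ using (ℕ; zero; suc; _∸_)
import Data.Nat.Properties as ℕ
open import Data.Product.Base using (_×_; _,_; ∃-syntax)
open import Data.Rational.Base as ℚ using (ℚ; ½; 1ℚ)
import Data.Rational.Properties as ℚ
open import Data.Rational.Solver using (module +-*-Solver)
open import Data.Sum.Base using (_⊎_; inj₁; inj₂)
open import Function.Base using (_∘_)
open import Relation.Binary.PropositionalEquality using (_≡_; _≢_; refl; sym; trans; cong; cong₂; module ≡-Reasoning)
open import Relation.Nullary.Decidable using (yes; no; ¬?; _×-dec_)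
open import Relation.Nullary.Negation using (¬_)
open import Relation.Unary using (Pred; Decidable)
open import Relation.Binary.Definitions using (DecidableEquality)

module RingNotation {c ℓ : Level} (R : RawRing c ℓ) where
  open RawRing R public using (Carrier; _≈_; _+_; _*_; -_; 0#; 1#; rawSemiring; +-rawMonoid)
  open RawSemiringDefinitions rawSemiring public using (_^_; sum)

  infixl 6 _-_
  _-_ : Carrier → Carrier → Carrier
  x - y = x + (- y)

  -- x is the fraction a / b: b is invertible and x = a b⁻¹.
  infix 4 _≈_÷_
  _≈_÷_ : Carrier → Carrier → Carrier → Set (c ⊔ ℓ)
  x ≈ a ÷ b = ∃[ b⁻¹ ] (b * b⁻¹ ≈ 1#) × (x ≈ a * b⁻¹)

module PowerSeries {c ℓ : Level} (R : RawRing c ℓ) where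
  private module R = RingNotation R

  Series : Set c
  Series = ℕ → R.Carrier

  const : R.Carrier → Series
  const a zero    = a
  const a (suc _) = R.0#

  X : Series
  X zero          = R.0#
  X (suc zero)    = R.1#
  X (suc (suc _)) = R.0#

  ring : RawRing c ℓ
  ring = record
    { Carrier = Series
    ; _≈_     = λ f g → ∀ n → f n R.≈ g n
    ; _+_     = λ f g n → f n R.+ g n
    ; _*_     = λ f g n → R.sum {suc n} (λ i → f (toℕ i) R.* g (n ∸ toℕ i))
    ; -_      = λ f n → R.- f n
    ; 0#      = const R.0#
    ; 1#      = const R.1#
    }

  -- The series Σₖ aₖ converges to b, coefficient by coefficient
  -- (with the discrete topology on the coefficients).
  SumsTo : (ℕ → Series) → Series → Set ℓ
  SumsTo a b = ∀ n → ∃[ K ] ∀ K′ → K ℕ.≤ K′ → R.sum {K′} (λ k → a (toℕ k) n) R.≈ b n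

module LaurentSeries {c ℓ : Level} (R : RawRing c ℓ) where
  open PowerSeries R using (Series; X) renaming (ring to R⟦X⟧)
  private module P = RingNotation R⟦X⟧

  -- f /X^ d stands for X⁻ᵈ f; representations are not unique, and the
  -- equality of the ring below identifies those of the same series.
  infix 5 _/X^_
  record Laurent : Set c where
    constructor _/X^_
    field
      num : Series
      ord : ℕ

  ring : RawRing c ℓ
  ring = record
    { Carrier = Laurent
    ; _≈_     = λ (f /X^ d) (g /X^ e) → (X P.^ e) P.* f P.≈ (X P.^ d) P.* g
    ; _+_     = λ (f /X^ d) (g /X^ e) → ((X P.^ e) P.* f) P.+ ((X P.^ d) P.* g) /X^ (d ℕ.+ e)
    ; _*_     = λ (f /X^ d) (g /X^ e) → (f P.* g) /X^ (d ℕ.+ e)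
    ; -_      = λ (f /X^ d) → (P.- f) /X^ d
    ; 0#      = P.0# /X^ 0
    ; 1#      = P.1# /X^ 0
    }

  fromSeries : Series → Laurent
  fromSeries f = f /X^ 0

ℚ-ring ℚ⟦z⟧ ℚ⸨z⸩ ℚ⟦z⟧⟦u⟧ ℚ⸨z⸩⟦u⟧ : RawRing 0ℓ 0ℓ
ℚ-ring    = ℚ.+-*-rawRing
ℚ⟦z⟧      = PowerSeries.ring ℚ-ring
ℚ⸨z⸩      = LaurentSeries.ring ℚ-ring
ℚ⟦z⟧⟦u⟧   = PowerSeries.ring ℚ⟦z⟧
ℚ⸨z⸩⟦u⟧   = PowerSeries.ring ℚ⸨z⸩

open PowerSeries ℚ-ring public using (Series; const; X)
open LaurentSeries ℚ-ring public using (Laurent; fromSeries; _/X^_)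

-- ℚ[[z]][[u]] → ℚ((z))[[u]]
embed : (ℕ → Series) → (ℕ → Laurent)
embed A k = fromSeries (A k)

module _ where
  open RingNotation ℚ⟦z⟧

  -- For f with constant term 1, √ f is the square root with constant term 1.
  -- Each step a ↦ a + ½ (f - a²) makes one more coefficient of a² agree
  -- with f, and the coefficient of degree n is final from step n on.
  √-step : Series → ℕ → Series
  √-step f zero    = 1#
  √-step f (suc n) = λ k → √-step f n k ℚ.+ ½ ℚ.* (f - √-step f n * √-step f n) k

  infix 9 √_
  √_ : Series → Series
  (√ f) n = √-step f n n

  private
    open +-*-Solver using (solve; con; _:+_; _:*_; :-_; _:=_)

    ∑ : ∀ {n} → (Fin n → ℚ) → ℚ
    ∑ = RingNotation.sum ℚ-ring

    middle : Series → ℕ → ℚ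
    middle a n = ∑ {n} λ i → a (suc (toℕ i)) ℚ.* a (n ∸ toℕ i)

    square-suc : ∀ a n → (a * a) (suc n) ≡ a 0 ℚ.* a (suc n) ℚ.+ (middle a n ℚ.+ a (suc n) ℚ.* a 0)
    square-suc a n = cong (a 0 ℚ.* a (suc n) ℚ.+_) (trans
      (sum-init-last (CommutativeMonoid.monoid ℚ.+-0-commutativeMonoid)
        (λ (i : Fin (suc n)) → a (suc (toℕ i)) ℚ.* a (n ∸ toℕ i)))
      (cong₂ ℚ._+_
        (sum-cong-≗ ℚ.+-0-commutativeMonoid {n = n}
          λ i → cong (λ j → a (suc j) ℚ.* a (n ∸ j)) (toℕ-inject₁ i))
        (trans (cong (λ j → a (suc j) ℚ.* a (n ∸ j)) (toℕ-fromℕ n))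
               (cong (λ j → a (suc n) ℚ.* a j) (ℕ.n∸n≡0 n)))))

    Agree : ℕ → Series → Series → Set
    Agree n a b = ∀ k → k ℕ.≤ n → a k ≡ b k

    middle-cong : ∀ {a b} n → Agree n a b → middle a n ≡ middle b n
    middle-cong n eq = sum-cong-≗ ℚ.+-0-commutativeMonoid λ i →
      cong₂ ℚ._*_ (eq (suc (toℕ i)) (toℕ<n i)) (eq (n ∸ toℕ i) (ℕ.m∸n≤m n (toℕ i)))

    square-cong : ∀ {a b} n → Agree n a b → (a * a) n ≡ (b * b) n
    square-cong n eq = sum-cong-≗ ℚ.+-0-commutativeMonoid {n = suc n} λ i →
      cong₂ ℚ._*_ (eq (toℕ i) (ℕ.s≤s⁻¹ (toℕ<n i))) (eq (n ∸ toℕ i) (ℕ.m∸n≤m n (toℕ i)))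

    correct-suc : ∀ x M c → let y = x ℚ.+ ½ ℚ.* (c ℚ.+ ℚ.- (1ℚ ℚ.* x ℚ.+ (M ℚ.+ x ℚ.* 1ℚ))) in
                  1ℚ ℚ.* y ℚ.+ (M ℚ.+ y ℚ.* 1ℚ) ≡ c
    correct-suc = solve 3 (λ x M c →
      let y = x :+ con ½ :* (c :+ :- (con 1ℚ :* x :+ (M :+ x :* con 1ℚ))) in
      con 1ℚ :* y :+ (M :+ y :* con 1ℚ) := c) refl

    module _ (f : Series) (f₀≡1 : f 0 ≡ 1ℚ) where
      Correct : ℕ → Set
      Correct n = Agree n (√-step f n * √-step f n) f

      step-agrees : ∀ n → Correct n → Agree n (√-step f (suc n)) (√-step f n)
      step-agrees n ih k k≤n = trans
        (cong (λ q → a k ℚ.+ ½ ℚ.* (f k ℚ.+ ℚ.- q)) (ih k k≤n))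
        (trans (cong (λ q → a k ℚ.+ ½ ℚ.* q) (ℚ.+-inverseʳ (f k))) (ℚ.+-identityʳ (a k)))
        where a = √-step f n

      step-correct : ∀ n → Correct n
      step-head    : ∀ n → √-step f n 0 ≡ 1ℚ
      step-head zero    = refl
      step-head (suc n) = trans (step-agrees n (step-correct n) 0 ℕ.z≤n) (step-head n)
      step-correct zero .0 ℕ.z≤n = sym f₀≡1
      step-correct (suc n) k k≤1+n with k ℕ.≤? n
      ... | yes k≤n = trans
        (square-cong k λ j j≤k → step-agrees n (step-correct n) j (ℕ.≤-trans j≤k k≤n))
        (step-correct n k k≤n)
      ... | no  k≰n with refl ← ℕ.≤-antisym k≤1+n (ℕ.≰⇒> k≰n) = begin
        (b * b) (suc n)
          ≡⟨ square-suc b n ⟩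
        b 0 ℚ.* b (suc n) ℚ.+ (middle b n ℚ.+ b (suc n) ℚ.* b 0)
          ≡⟨ cong₂ (λ h M → h ℚ.* b (suc n) ℚ.+ (M ℚ.+ b (suc n) ℚ.* h))
               (trans (step-agrees n (step-correct n) 0 ℕ.z≤n) (step-head n)) (middle-cong n (step-agrees n (step-correct n))) ⟩
        1ℚ ℚ.* b (suc n) ℚ.+ (middle a n ℚ.+ b (suc n) ℚ.* 1ℚ)
          ≡⟨ cong (λ y → 1ℚ ℚ.* y ℚ.+ (middle a n ℚ.+ y ℚ.* 1ℚ))
               (cong (λ q → a (suc n) ℚ.+ ½ ℚ.* (f (suc n) ℚ.+ ℚ.- q))
                 (trans (square-suc a n)
                   (cong (λ h → h ℚ.* a (suc n) ℚ.+ (middle a n ℚ.+ a (suc n) ℚ.* h)) (step-head n)))) ⟩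
        _ ≡⟨ correct-suc (a (suc n)) (middle a n) (f (suc n)) ⟩
        f (suc n) ∎
        where
        open ≡-Reasoning
        a b : Series
        a = √-step f n
        b = √-step f (suc n)

      step-final : ∀ n k → k ℕ.≤ n → √-step f n k ≡ (√ f) k
      step-final zero    .0 ℕ.z≤n = refl
      step-final (suc n) k k≤1+n with k ℕ.≤? n
      ... | yes k≤n = trans (step-agrees n (step-correct n) k k≤n) (step-final n k k≤n)
      ... | no  k≰n with refl ← ℕ.≤-antisym k≤1+n (ℕ.≰⇒> k≰n) = refl

  √-head : ∀ f → (√ f) 0 ≡ 1ℚ
  √-head f = refl

  √-square : ∀ f → f 0 ≡ 1ℚ → (√ f) * (√ f) ≈ f
  √-square f f₀≡1 n = trans
    (square-cong n λ k k≤n → sym (step-final f f₀≡1 n k k≤n))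
    (step-correct f f₀≡1 n n ℕ.≤-refl)

-- ½ · (…) /X^ 3 is the division by 2z³.
module Roots where
  open RingNotation ℚ⟦z⟧

  Δ : Series
  Δ = X ^ 8 - (1# + 1#) * X ^ 6 - X ^ 4 - (1# + 1#) * X ^ 2 + 1#

  r s : Laurent
  r = const ½ * (1# - X ^ 4 - X ^ 2 - √ Δ) /X^ 3
  s = const ½ * (1# - X ^ 4 - X ^ 2 + √ Δ) /X^ 3

module Univariate where
  open RingNotation ℚ⸨z⸩ public
  open Roots public using (r; s)

  z : Laurent
  z = fromSeries X

module Bivariate where
  open RingNotation ℚ⸨z⸩⟦u⟧ public

  u z r s : Carrier
  u = PowerSeries.X ℚ⸨z⸩
  z = PowerSeries.const ℚ⸨z⸩ Univariate.z
  r = PowerSeries.const ℚ⸨z⸩ Univariate.r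
  s = PowerSeries.const ℚ⸨z⸩ Univariate.s

data Direction : Set where
  up down : Direction

_≟ᵈ_ : DecidableEquality Direction
up   ≟ᵈ up   = yes refl
up   ≟ᵈ down = no λ ()
down ≟ᵈ up   = no λ ()
down ≟ᵈ down = yes refl

data Step : Set where
  N N̄ E Ē : Step

Δx : Step → ℕ
Δx N = 1
Δx N̄ = 1
Δx E = 2
Δx Ē = 2

Δy : Step → ℤ
Δy N = + 2
Δy N̄ = ℤ.- + 2
Δy E = + 1
Δy Ē = ℤ.- + 1

direction : Step → Direction
direction N = up
direction N̄ = down
direction E = up
direction Ē = down

Path : Set
Path = List Step

size : Path → ℕ
size = foldr (λ e x → Δx e ℕ.+ x) 0

altitude : Path → ℤ
altitude = foldr (λ e y → Δy e ℤ.+ y) (+ 0)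

Zigzag : Pred Path 0ℓ
Zigzag = Linked (λ d e → direction d ≢ direction e)

-- The points of a path are the endpoints of its initial segments.
StaysAbove : ℤ → Pred Path 0ℓ
StaysAbove b p = All (λ q → b ℤ.≤ altitude q) (inits p)

-- The empty path, which has no last step, satisfies EndsUp but not EndsDown.
EndsUp EndsDown : Pred Path 0ℓ
EndsUp   p = MaybeAll.All (λ e → direction e ≡ up)   (last p)
EndsDown p = MaybeAny.Any (λ e → direction e ≡ down) (last p)

Admissible : ℕ → Pred Path 0ℓ
Admissible m p = Zigzag p × StaysAbove (ℤ.- + m) p

EndsAt : ℤ → Pred Path 0ℓ
EndsAt y p = altitude p ≡ y

admissible? : ∀ m → Decidable (Admissible m)
admissible? m p = linked? (λ d e → ¬? (direction d ≟ᵈ direction e)) p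
              ×-dec all? (λ q → ℤ.- + m ℤ.≤? altitude q) (inits p)

endsAt? : ∀ y → Decidable (EndsAt y)
endsAt? y p = altitude p ℤ.≟ y

endsUp? : Decidable EndsUp
endsUp? p = MaybeAll.dec (λ e → direction e ≟ᵈ up) (last p)

endsDown? : Decidable EndsDown
endsDown? p = MaybeAny.dec (λ e → direction e ≟ᵈ down) (last p)

-- The three lemmas below show that this lists each path of size n exactly once.
pathsOfSize : ℕ → List Path
pathsOfSize zero          = [] ∷ []
pathsOfSize (suc zero)    = map (N ∷_) (pathsOfSize 0) ++ map (N̄ ∷_) (pathsOfSize 0)
pathsOfSize (suc (suc n)) =
     (map (N ∷_) (pathsOfSize (suc n)) ++ map (N̄ ∷_) (pathsOfSize (suc n)))
  ++ (map (E ∷_) (pathsOfSize n)       ++ map (Ē ∷_) (pathsOfSize n))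

size-pathsOfSize : ∀ n {p} → p ∈ pathsOfSize n → size p ≡ n
size-pathsOfSize zero (here refl) = refl
size-pathsOfSize (suc zero) (here refl) = refl
size-pathsOfSize (suc zero) (there (here refl)) = refl
size-pathsOfSize (suc (suc n)) p∈ with ∈-++⁻ (map (N ∷_) (pathsOfSize (suc n)) ++ map (N̄ ∷_) (pathsOfSize (suc n))) p∈
... | inj₁ p∈ with ∈-++⁻ (map (N ∷_) (pathsOfSize (suc n))) p∈
...   | inj₁ p∈ with _ , q∈ , refl ← ∈-map⁻ _ p∈ = cong suc (size-pathsOfSize (suc n) q∈)
...   | inj₂ p∈ with _ , q∈ , refl ← ∈-map⁻ _ p∈ = cong suc (size-pathsOfSize (suc n) q∈)
size-pathsOfSize (suc (suc n)) _ | inj₂ p∈ with ∈-++⁻ (map (E ∷_) (pathsOfSize n)) p∈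
...   | inj₁ p∈ with _ , q∈ , refl ← ∈-map⁻ _ p∈ = cong (suc ∘ suc) (size-pathsOfSize n q∈)
...   | inj₂ p∈ with _ , q∈ , refl ← ∈-map⁻ _ p∈ = cong (suc ∘ suc) (size-pathsOfSize n q∈)

∈-pathsOfSize : ∀ p → p ∈ pathsOfSize (size p)
∈-pathsOfSize []      = here refl
∈-pathsOfSize (N ∷ p) with size p | ∈-pathsOfSize p
... | zero  | p∈ = ∈-++⁺ˡ (∈-map⁺ (N ∷_) p∈)
... | suc n | p∈ = ∈-++⁺ˡ (∈-++⁺ˡ (∈-map⁺ (N ∷_) p∈))
∈-pathsOfSize (N̄ ∷ p) with size p | ∈-pathsOfSize p
... | zero  | p∈ = ∈-++⁺ʳ (map (N ∷_) (pathsOfSize 0)) (∈-map⁺ (N̄ ∷_) p∈)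
... | suc n | p∈ = ∈-++⁺ˡ (∈-++⁺ʳ (map (N ∷_) (pathsOfSize (suc n))) (∈-map⁺ (N̄ ∷_) p∈))
∈-pathsOfSize (E ∷ p) =
  ∈-++⁺ʳ (map (N ∷_) (pathsOfSize (suc (size p))) ++ _) (∈-++⁺ˡ (∈-map⁺ (E ∷_) (∈-pathsOfSize p)))
∈-pathsOfSize (Ē ∷ p) =
  ∈-++⁺ʳ (map (N ∷_) (pathsOfSize (suc (size p))) ++ _)
    (∈-++⁺ʳ (map (E ∷_) (pathsOfSize (size p))) (∈-map⁺ (Ē ∷_) (∈-pathsOfSize p)))

pathsOfSize-unique : ∀ n → Unique (pathsOfSize n)
pathsOfSize-unique zero       = All.[] ∷ []
pathsOfSize-unique (suc zero) = ((λ ()) All.∷ All.[]) ∷ (All.[] ∷ [])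
pathsOfSize-unique (suc (suc n)) =
  Unique.++⁺ (Unique.++⁺ (extend (suc n)) (extend (suc n)) (disjoint λ ()))
             (Unique.++⁺ (extend n) (extend n) (disjoint λ ()))
             λ (p∈ , q∈) → crossing (∈-++⁻ (map (N ∷_) (pathsOfSize (suc n))) p∈)
                                    (∈-++⁻ (map (E ∷_) (pathsOfSize n)) q∈)
  where
  extend : ∀ {e} n → Unique (map (e ∷_) (pathsOfSize n))
  extend n = Unique.map⁺ List.∷-injectiveʳ (pathsOfSize-unique n)

  disjoint : ∀ {d e ps qs} {p : Path} → d ≢ e → ¬ (p ∈ map (d ∷_) ps × p ∈ map (e ∷_) qs)
  disjoint d≢e (p∈ , q∈) with _ , _ , refl ← ∈-map⁻ _ p∈ | _ , _ , eq ← ∈-map⁻ _ q∈ =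
    d≢e (List.∷-injectiveˡ eq)

  crossing : ∀ {p ps ps′ qs qs′} → p ∈ map (N ∷_) ps ⊎ p ∈ map (N̄ ∷_) ps′ →
             ¬ (p ∈ map (E ∷_) qs ⊎ p ∈ map (Ē ∷_) qs′)
  crossing (inj₁ p∈) (inj₁ q∈) = disjoint (λ ()) (p∈ , q∈)
  crossing (inj₁ p∈) (inj₂ q∈) = disjoint (λ ()) (p∈ , q∈)
  crossing (inj₂ p∈) (inj₁ q∈) = disjoint (λ ()) (p∈ , q∈)
  crossing (inj₂ p∈) (inj₂ q∈) = disjoint (λ ()) (p∈ , q∈)

count : {P : Pred Path 0ℓ} → Decidable P → ℕ → ℕ
count P? n = length (filter P? (pathsOfSize n))

generatingFunction : {P : Pred Path 0ℓ} → Decidable P → Series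
generatingFunction P? n = + count P? n ℚ./ 1

-- f m k is f₋ₘ₊ₖ and g m k is g₋ₘ₊ₖ.
f g : ℕ → ℕ → Series
f m k = generatingFunction λ p → admissible? m p ×-dec endsAt? (ℤ.- + m ℤ.+ + k) p ×-dec endsUp? p
g m k = generatingFunction λ p → admissible? m p ×-dec endsAt? (ℤ.- + m ℤ.+ + k) p ×-dec endsDown? p

total : ℕ → Series
total m = generatingFunction (admissible? m)

F G H : ℕ → RawRing.Carrier ℚ⟦z⟧⟦u⟧
F m k = f m k
G m k = g m k
H m   = RawRing._+_ ℚ⟦z⟧⟦u⟧ (F m) (G m)

-- A(1) = a for A in ℚ[[z]][[u]].
ValueAtOne : RawRing.Carrier ℚ⟦z⟧⟦u⟧ → Series → Set
ValueAtOne = PowerSeries.SumsTo ℚ-ring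

{-# OPTIONS --safe #-}
module Submission where

-- Removing the last step of a path expresses f through g and g through f. Written for F(u) and G(u), these
-- recurrences give u G(u) + z f₋ₘ₊₁ = (z + z²u) (uᵐ⁻¹ P(u) + (zu + z²) G(u)) with P(u) = 1 + z²u + zu², that is,
--   z³ (u - r) (u - s) G(u) = z f₋ₘ₊₁ - z uᵐ⁻¹ (1 + zu) P(u).
-- As r is a power series in z without constant term, u = r may be substituted (the kernel method), which
-- yields z f₋ₘ₊₁ = rᵐ⁻¹ (z + z²r + r²), hence G(u) and F(u). Forgetting the altitude in the same recurrences
-- gives H(1) + z f₋ₘ₊₁ = 1 + z + z² + (z + z²) H(1).

open import Algebra.Bundles using (AbelianGroup; CommutativeRing; RawRing)
open import Algebra.Morphism.Structures using (IsRingHomomorphism)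
open import Data.Integer.Base as ℤ using (ℤ; +_; -[1+_]; _⊖_; 0ℤ)
import Data.Integer.Properties as ℤ
open import Data.Maybe.Base using (Maybe; just; nothing)
open import Data.Nat.Base as ℕ using (ℕ; zero; suc; _∸_; _≤_; z≤n; s≤s)
import Data.Nat.Properties as ℕ
open import Data.Product.Base using (_×_; _,_; ∃-syntax; proj₁; proj₂; map₂)
open import Function.Base using (_∘_; id)
open import Level using (Level; 0ℓ; _⊔_)
open import Relation.Binary.PropositionalEquality as ≡ using (_≡_; _≢_)
open import Relation.Nullary.Decidable using (yes; no; _×-dec_; _⊎-dec_)
open import Relation.Nullary.Negation using (¬_)

import Defs
open Defs using (module PowerSeries; module LaurentSeries; module RingNotation)

-- Algebra of formal series

-- The substitution and the closed forms need different coefficients. Substituting u = r rests on z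
-- dividing r: a series divisible by every power of z is zero, which fails once z is a unit. The
-- denominator z³ (u - r) (u - s), on the other hand, has constant term z³ in u, so it is invertible
-- only when z is. Hence the boundary value f₋ₘ₊₁ is computed with coefficients in power series,
-- then carried by ring homomorphisms to Laurent coefficients, where the quotients are formed. That
-- r is a power series is invisible in its definition as a numerator over z³. The numerators of r
-- and s multiply to z⁶, and that of s has constant term 1, so r equals z³ divided by the numerator
-- of s. Nothing is literally evaluated at u = r. Instead, the difference of the two sides of the
-- claimed boundary identity is exhibited as a multiple of u - r; being free of u, it must vanish.

module IntegerSolver {c ℓ : Level} (R : CommutativeRing c ℓ) where
  open CommutativeRing R
  open import Algebra.Properties.Ring ring using (-‿distribˡ-*; -‿distribʳ-*)
  open import Algebra.Properties.AbelianGroup +-abelianGroup using (⁻¹-∙-comm; ⁻¹-involutive; ε⁻¹≈ε)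
  open import Algebra.Properties.CommutativeSemigroup +-commutativeSemigroup using (interchange)
  open import Algebra.Properties.Semiring.Mult.TCOptimised semiring using (×-homo-+; ×1-homo-*; 1+×) renaming (_×_ to infixl 8 _·_)
  open import Algebra.Solver.Ring.AlmostCommutativeRing using (fromCommutativeRing; _-Raw-AlmostCommutative⟶_)
  open import Relation.Binary.Reasoning.Setoid setoid

  private
    -- Equality in an arbitrary ring is not decidable, so the solver computes with integer
    -- coefficients. With the optimised multiples `+ 1` is sent to `1#` definitionally, so that `𝟙`
    -- denotes `1#` itself.
    ⟦_⟧ : ℤ → Carrier
    ⟦ + n ⟧      = n · 1#
    ⟦ -[1+ n ] ⟧ = - (suc n · 1#)

    ⊖-homo : ∀ m n → ⟦ m ⊖ n ⟧ ≈ m · 1# - n · 1#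
    ⊖-homo m zero          = sym (trans (+-congˡ ε⁻¹≈ε) (+-identityʳ _))
    ⊖-homo zero (suc n)    = sym (+-identityˡ _)
    ⊖-homo (suc m) (suc n) = begin
      ⟦ suc m ⊖ suc n ⟧                  ≡⟨ ≡.cong ⟦_⟧ (ℤ.[1+m]⊖[1+n]≡m⊖n m n) ⟩
      ⟦ m ⊖ n ⟧                          ≈⟨ ⊖-homo m n ⟩
      m · 1# - n · 1#                    ≈⟨ +-identityˡ _ ⟨
      0# + (m · 1# - n · 1#)             ≈⟨ +-congʳ (-‿inverseʳ 1#) ⟨
      1# - 1# + (m · 1# - n · 1#)        ≈⟨ interchange _ _ _ _ ⟩
      1# + m · 1# + (- 1# - n · 1#)      ≈⟨ +-congˡ (⁻¹-∙-comm _ _) ⟩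
      1# + m · 1# - (1# + n · 1#)        ≈⟨ +-cong (1+× m 1#) (-‿cong (1+× n 1#)) ⟨
      suc m · 1# - suc n · 1#            ∎

    +-homo : ∀ i j → ⟦ i ℤ.+ j ⟧ ≈ ⟦ i ⟧ + ⟦ j ⟧
    +-homo (+ m)    (+ n)    = ×-homo-+ 1# m n
    +-homo (+ m)    -[1+ n ] = ⊖-homo m (suc n)
    +-homo -[1+ m ] (+ n)    = trans (⊖-homo n (suc m)) (+-comm _ _)
    +-homo -[1+ m ] -[1+ n ] = begin
      - (suc (suc (m ℕ.+ n)) · 1#)        ≡⟨ ≡.cong (λ k → - (suc k · 1#)) (ℕ.+-suc m n) ⟨
      - ((suc m ℕ.+ suc n) · 1#)          ≈⟨ -‿cong (×-homo-+ 1# (suc m) (suc n)) ⟩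
      - (suc m · 1# + suc n · 1#)         ≈⟨ ⁻¹-∙-comm _ _ ⟨
      - (suc m · 1#) - suc n · 1#         ∎

    -‿homo : ∀ i → ⟦ ℤ.- i ⟧ ≈ - ⟦ i ⟧
    -‿homo (+ zero)  = sym ε⁻¹≈ε
    -‿homo (+ suc n) = refl
    -‿homo -[1+ n ]  = sym (⁻¹-involutive _)

    pos-*-homo : ∀ m j → ⟦ + m ℤ.* j ⟧ ≈ m · 1# * ⟦ j ⟧
    pos-*-homo m (+ n)    = trans (reflexive (≡.cong ⟦_⟧ (≡.sym (ℤ.pos-* m n)))) (×1-homo-* m n)
    pos-*-homo m -[1+ n ] = begin
      ⟦ + m ℤ.* -[1+ n ] ⟧          ≡⟨ ≡.cong ⟦_⟧ (ℤ.neg-distribʳ-* (+ m) (+ suc n)) ⟨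
      ⟦ ℤ.- (+ m ℤ.* + suc n) ⟧     ≈⟨ -‿homo (+ m ℤ.* + suc n) ⟩
      - ⟦ + m ℤ.* + suc n ⟧         ≈⟨ -‿cong (pos-*-homo m (+ suc n)) ⟩
      - (m · 1# * (suc n · 1#))     ≈⟨ -‿distribʳ-* _ _ ⟩
      m · 1# * - (suc n · 1#)       ∎

    *-homo : ∀ i j → ⟦ i ℤ.* j ⟧ ≈ ⟦ i ⟧ * ⟦ j ⟧
    *-homo (+ m)    j = pos-*-homo m j
    *-homo -[1+ m ] j = begin
      ⟦ -[1+ m ] ℤ.* j ⟧            ≡⟨ ≡.cong ⟦_⟧ (ℤ.neg-distribˡ-* (+ suc m) j) ⟨
      ⟦ ℤ.- (+ suc m ℤ.* j) ⟧       ≈⟨ -‿homo (+ suc m ℤ.* j) ⟩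
      - ⟦ + suc m ℤ.* j ⟧           ≈⟨ -‿cong (pos-*-homo (suc m) j) ⟩
      - (suc m · 1# * ⟦ j ⟧)        ≈⟨ -‿distribˡ-* _ _ ⟩
      - (suc m · 1#) * ⟦ j ⟧        ∎

    homomorphism : CommutativeRing.rawRing ℤ.+-*-commutativeRing -Raw-AlmostCommutative⟶ fromCommutativeRing R
    homomorphism = record
      { ⟦_⟧    = ⟦_⟧
      ; +-homo = +-homo
      ; *-homo = *-homo
      ; -‿homo = -‿homo
      ; 0-homo = refl
      ; 1-homo = refl
      }

    _coeff≟_ : ∀ i j → Maybe (⟦ i ⟧ ≈ ⟦ j ⟧)
    i coeff≟ j with i ℤ.≟ j
    ... | yes i≡j = just (reflexive (≡.cong ⟦_⟧ i≡j))
    ... | no  _   = nothing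

  open import Algebra.Solver.Ring _ _ homomorphism _coeff≟_ public
    using (Polynomial; solve; con; _:+_; _:*_; _:-_; :-_; _:^_; _:=_)

  𝟙 : ∀ {n} → Polynomial n
  𝟙 = con (+ 1)

module PowerSeriesRing {c ℓ : Level} (R : CommutativeRing c ℓ) where
  open CommutativeRing R
  open IntegerSolver R
  open import Relation.Binary.Reasoning.Setoid setoid
  open PowerSeries rawRing using (const; X) renaming (Series to Seq; ring to R⟦X⟧)
  private module S = RingNotation R⟦X⟧

  -- By computation `(f S.* g) (suc n)` is `f 0 * g (suc n) + ((f ∘ suc) S.* g) n`. This and the
  -- proofs below therefore recurse on the degree, peeling off the constant term of the left factor.
  *-cong-≈ : ∀ {f f′ g g′} → f S.≈ f′ → g S.≈ g′ → f S.* g S.≈ f′ S.* g′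
  *-cong-≈ f≈ g≈ zero    = +-congʳ (*-cong (f≈ 0) (g≈ 0))
  *-cong-≈ f≈ g≈ (suc n) = +-cong (*-cong (f≈ 0) (g≈ (suc n))) (*-cong-≈ (f≈ ∘ suc) g≈ n)

  private
    scale : Carrier → Seq → Seq
    scale a f n = a * f n

    scale-* : ∀ a f g n → (scale a f S.* g) n ≈ a * (f S.* g) n
    scale-* a f g zero    = solve 3 (λ a x y → (a :* x) :* y :+ con 0ℤ := a :* (x :* y :+ con 0ℤ)) refl _ _ _
    scale-* a f g (suc n) = begin
      a * f 0 * g (suc n) + (scale a (f ∘ suc) S.* g) n    ≈⟨ +-cong (*-assoc _ _ _) (scale-* a (f ∘ suc) g n) ⟩
      a * (f 0 * g (suc n)) + a * ((f ∘ suc) S.* g) n      ≈⟨ distribˡ _ _ _ ⟨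
      a * (f S.* g) (suc n)                                ∎

  *-vanish : ∀ f g n → (∀ k → k ≤ n → f k ≈ 0#) → (f S.* g) n ≈ 0#
  *-vanish f g zero    f≈0 = trans (+-identityʳ _) (trans (*-congʳ (f≈0 0 z≤n)) (zeroˡ _))
  *-vanish f g (suc n) f≈0 = trans (+-cong (trans (*-congʳ (f≈0 0 z≤n)) (zeroˡ _)) (*-vanish (f ∘ suc) g n λ k k≤n → f≈0 (suc k) (s≤s k≤n)))
    (+-identityʳ _)

  *-distribʳ-≈ : ∀ h f g → (f S.+ g) S.* h S.≈ f S.* h S.+ g S.* h
  *-distribʳ-≈ h f g zero    = solve 3 (λ h f g → (f :+ g) :* h :+ con 0ℤ := (f :* h :+ con 0ℤ) :+ (g :* h :+ con 0ℤ)) refl _ _ _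
  *-distribʳ-≈ h f g (suc n) = begin
    (f 0 + g 0) * h (suc n) + (((f S.+ g) ∘ suc) S.* h) n
      ≈⟨ +-cong (distribʳ _ _ _) (*-distribʳ-≈ h (f ∘ suc) (g ∘ suc) n) ⟩
    (f 0 * h (suc n) + g 0 * h (suc n)) + (((f ∘ suc) S.* h) n + ((g ∘ suc) S.* h) n)
      ≈⟨ solve 4 (λ a b c d → (a :+ b) :+ (c :+ d) := (a :+ c) :+ (b :+ d)) refl _ _ _ _ ⟩
    (f S.* h S.+ g S.* h) (suc n) ∎

  -- The tail of `f S.* g` is by computation `scale (f 0) (g ∘ suc) S.+ ((f ∘ suc) S.* g)`;
  -- distributivity splits it, and the second summand is the induction hypothesis.
  *-assoc-≈ : ∀ f g h → (f S.* g) S.* h S.≈ f S.* (g S.* h)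
  *-assoc-≈ f g h zero    = solve 3 (λ f g h → (f :* g :+ con 0ℤ) :* h :+ con 0ℤ := f :* (g :* h :+ con 0ℤ) :+ con 0ℤ) refl _ _ _
  *-assoc-≈ f g h (suc n) = begin
    (f 0 * g 0 + 0#) * h (suc n) + ((scale (f 0) (g ∘ suc) S.+ ((f ∘ suc) S.* g)) S.* h) n
      ≈⟨ +-cong (*-congʳ (+-identityʳ _)) (*-distribʳ-≈ h (scale (f 0) (g ∘ suc)) ((f ∘ suc) S.* g) n) ⟩
    f 0 * g 0 * h (suc n) + ((scale (f 0) (g ∘ suc) S.* h) n + (((f ∘ suc) S.* g) S.* h) n)
      ≈⟨ +-congˡ (+-cong (scale-* (f 0) (g ∘ suc) h n) (*-assoc-≈ (f ∘ suc) g h n)) ⟩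
    f 0 * g 0 * h (suc n) + (f 0 * ((g ∘ suc) S.* h) n + ((f ∘ suc) S.* (g S.* h)) n)
      ≈⟨ solve 5 (λ a b c d e → a :* b :* c :+ (a :* d :+ e) := a :* (b :* c :+ d) :+ e) refl _ _ _ _ _ ⟩
    f 0 * (g S.* h) (suc n) + ((f ∘ suc) S.* (g S.* h)) n ∎

  private
    -- Peels the convolution at its other end, which is what commutativity needs: there the constant
    -- term to split off belongs to the right factor.
    *-last : ∀ f g n → (f S.* g) (suc n) ≈ (f S.* (g ∘ suc)) n + f (suc n) * g 0
    *-last f g zero    = solve 2 (λ a b → a :+ (b :+ con 0ℤ) := (a :+ con 0ℤ) :+ b) refl _ _
    *-last f g (suc n) = trans (+-congˡ (*-last (f ∘ suc) g n)) (sym (+-assoc _ _ _))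

  *-comm-≈ : ∀ f g → f S.* g S.≈ g S.* f
  *-comm-≈ f g zero    = +-congʳ (*-comm _ _)
  *-comm-≈ f g (suc n) = begin
    f 0 * g (suc n) + ((f ∘ suc) S.* g) n   ≈⟨ +-cong (*-comm _ _) (*-comm-≈ (f ∘ suc) g n) ⟩
    g (suc n) * f 0 + (g S.* (f ∘ suc)) n   ≈⟨ +-comm _ _ ⟩
    (g S.* (f ∘ suc)) n + g (suc n) * f 0   ≈⟨ *-last g f n ⟨
    (g S.* f) (suc n)                       ∎

  const-* : ∀ a f n → (const a S.* f) n ≈ a * f n
  const-* a f zero    = +-identityʳ _
  const-* a f (suc n) = trans (+-congˡ (*-vanish (λ _ → 0#) f n λ _ _ → refl)) (+-identityʳ _)

  *-identityˡ-≈ : ∀ f → S.1# S.* f S.≈ f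
  *-identityˡ-≈ f n = trans (const-* 1# f n) (*-identityˡ _)

  const-cong : ∀ {a b} → a ≈ b → const a S.≈ const b
  const-cong a≈b zero    = a≈b
  const-cong a≈b (suc n) = refl

  private
    const-0-≈ : ∀ n → const 0# n ≈ 0#
    const-0-≈ zero    = refl
    const-0-≈ (suc n) = refl

  X*-zero : ∀ f → (X S.* f) 0 ≈ 0#
  X*-zero f = trans (+-identityʳ _) (zeroˡ _)

  X*-suc : ∀ f n → (X S.* f) (suc n) ≈ f n
  X*-suc f n = trans (+-cong (zeroˡ _) (trans (*-cong-≈ {g = f} shift (λ _ → refl) n) (*-identityˡ-≈ f n))) (+-identityˡ _)
    where
    shift : (X ∘ suc) S.≈ S.1#
    shift zero    = refl
    shift (suc n) = refl

  X*-cancelˡ : ∀ {f g} → X S.* f S.≈ X S.* g → f S.≈ g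
  X*-cancelˡ {f} {g} eq n = trans (sym (X*-suc f n)) (trans (eq (suc n)) (X*-suc g n))

  X^*-cancelˡ : ∀ d {f g} → (X S.^ d) S.* f S.≈ (X S.^ d) S.* g → f S.≈ g
  X^*-cancelˡ zero    {f} {g} eq n = trans (sym (*-identityˡ-≈ f n)) (trans (eq n) (*-identityˡ-≈ g n))
  X^*-cancelˡ (suc d) {f} {g} eq = X^*-cancelˡ d (X*-cancelˡ λ n →
    trans (sym (*-assoc-≈ X (X S.^ d) f n)) (trans (eq n) (*-assoc-≈ X (X S.^ d) g n)))

  -- The coefficients obey `h (suc n) = - (b * ((f ∘ suc) S.* h) n)`, where the right side consults
  -- all lower ones, so the recursion is not structural. The approximations are iterated instead,
  -- and `h` is their diagonal.
  inverse : ∀ f b → f 0 * b ≈ 1# → ∃[ f⁻¹ ] f S.* f⁻¹ S.≈ S.1#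
  inverse f b f₀b≈1 = h , correct
    where
    open import Data.Nat.Properties using (≤-refl; ≤-trans; n≤1+n)
    -- approx n is correct up to degree n.
    approx : ℕ → Seq
    approx zero    k = b
    approx (suc n) zero    = b
    approx (suc n) (suc k) = - (b * ((f ∘ suc) S.* approx n) k)

    h : Seq
    h n = approx n n

    *-congʳ-≤ : ∀ f {g g′} n → (∀ k → k ≤ n → g k ≈ g′ k) → (f S.* g) n ≈ (f S.* g′) n
    *-congʳ-≤ f zero    eq = +-congʳ (*-congˡ (eq 0 z≤n))
    *-congʳ-≤ f (suc n) eq = +-cong (*-congˡ (eq (suc n) ≤-refl)) (*-congʳ-≤ (f ∘ suc) n λ k k≤n → eq k (≤-trans k≤n (n≤1+n n)))

    agree : ∀ m n k → k ≤ m → k ≤ n → approx m k ≈ approx n k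
    agree zero    zero    zero    _ _ = refl
    agree zero    (suc n) zero    _ _ = refl
    agree (suc m) zero    zero    _ _ = refl
    agree (suc m) (suc n) zero    _ _ = refl
    agree (suc m) (suc n) (suc k) (s≤s k≤m) (s≤s k≤n) = -‿cong (*-congˡ (*-congʳ-≤ (f ∘ suc) k λ j j≤k →
      agree m n j (≤-trans j≤k k≤m) (≤-trans j≤k k≤n)))

    correct : f S.* h S.≈ S.1#
    correct zero    = trans (+-identityʳ _) f₀b≈1
    correct (suc n) = begin
      f 0 * - (b * ((f ∘ suc) S.* approx n) n) + ((f ∘ suc) S.* h) n
        ≈⟨ +-congʳ (*-congˡ (-‿cong (*-congˡ (*-congʳ-≤ (f ∘ suc) n λ k k≤n → agree n k k k≤n ≤-refl)))) ⟩
      f 0 * - (b * ((f ∘ suc) S.* h) n) + ((f ∘ suc) S.* h) n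
        ≈⟨ solve 3 (λ a b c → a :* :- (b :* c) :+ c := (𝟙 :- a :* b) :* c) refl _ _ _ ⟩
      (1# - f 0 * b) * ((f ∘ suc) S.* h) n
        ≈⟨ *-congʳ (trans (+-congˡ (-‿cong f₀b≈1)) (-‿inverseʳ 1#)) ⟩
      0# * ((f ∘ suc) S.* h) n
        ≈⟨ zeroˡ _ ⟩
      0# ∎

  commutativeRing : CommutativeRing c ℓ
  commutativeRing = record
    { RawRing R⟦X⟧
    ; isCommutativeRing = record
      { isRing = record
        { +-isAbelianGroup = record
          { isGroup = record
            { isMonoid = record
              { isSemigroup = record
                { isMagma = record
                  { isEquivalence = record
                    { refl  = λ _ → refl
                    ; sym   = λ p n → sym (p n)
                    ; trans = λ p q n → trans (p n) (q n)
                    }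
                  ; ∙-cong = λ p q n → +-cong (p n) (q n)
                  }
                ; assoc = λ f g h n → +-assoc (f n) (g n) (h n)
                }
              ; identity = (λ f n → trans (+-congʳ (const-0-≈ n)) (+-identityˡ (f n)))
                         , (λ f n → trans (+-congˡ (const-0-≈ n)) (+-identityʳ (f n)))
              }
            ; inverse = (λ f n → trans (-‿inverseˡ (f n)) (sym (const-0-≈ n)))
                      , (λ f n → trans (-‿inverseʳ (f n)) (sym (const-0-≈ n)))
            ; ⁻¹-cong = λ p n → -‿cong (p n)
            }
          ; comm = λ f g n → +-comm (f n) (g n)
          }
        ; *-cong     = *-cong-≈
        ; *-assoc    = *-assoc-≈
        ; *-identity = *-identityˡ-≈ , λ f n → trans (*-comm-≈ f S.1# n) (*-identityˡ-≈ f n)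
        ; distrib    = (λ f g h n → trans (*-comm-≈ f (g S.+ h) n)
                          (trans (*-distribʳ-≈ f g h n) (+-cong (*-comm-≈ g f n) (*-comm-≈ h f n))))
                     , *-distribʳ-≈
        }
      ; *-comm = *-comm-≈
      }
    }

module _ {c ℓ c′ ℓ′ : Level} (R : CommutativeRing c ℓ) (S : CommutativeRing c′ ℓ′) where
  private
    module R = CommutativeRing R
    module S = CommutativeRing S

  ringHomomorphism : (φ : R.Carrier → S.Carrier) →
    (∀ {x y} → x R.≈ y → φ x S.≈ φ y) →
    (∀ x y → φ (x R.+ y) S.≈ φ x S.+ φ y) →
    (∀ x y → φ (x R.* y) S.≈ φ x S.* φ y) →
    (∀ x → φ (R.- x) S.≈ S.- φ x) →
    φ R.0# S.≈ S.0# → φ R.1# S.≈ S.1# →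
    IsRingHomomorphism R.rawRing S.rawRing φ
  ringHomomorphism φ φ-cong φ-+ φ-* φ-neg φ-0 φ-1 = record
    { isSemiringHomomorphism = record
      { isNearSemiringHomomorphism = record
        { +-isMonoidHomomorphism = record
          { isMagmaHomomorphism = record
            { isRelHomomorphism = record { cong = φ-cong }
            ; homo = φ-+
            }
          ; ε-homo = φ-0
          }
        ; *-homo = φ-*
        }
      ; 1#-homo = φ-1
      }
    ; -‿homo = φ-neg
    }

module HomProperties {c ℓ c′ ℓ′ : Level} (R : CommutativeRing c ℓ) (S : CommutativeRing c′ ℓ′)
  {φ : CommutativeRing.Carrier R → CommutativeRing.Carrier S}
  (φ-hom : IsRingHomomorphism (CommutativeRing.rawRing R) (CommutativeRing.rawRing S) φ) where
  private
    module R = CommutativeRing R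
    module S = CommutativeRing S
    module R^ = RingNotation R.rawRing
    module S^ = RingNotation S.rawRing
  open IsRingHomomorphism φ-hom public using (⟦⟧-cong; +-homo; *-homo; -‿homo; 0#-homo; 1#-homo)

  ^-homo : ∀ x n → φ (x R^.^ n) S.≈ φ x S^.^ n
  ^-homo x zero    = 1#-homo
  ^-homo x (suc n) = S.trans (*-homo x _) (S.*-congˡ (^-homo x n))

  open PowerSeries R.rawRing using (const; X) renaming (ring to R⟦X⟧)
  open PowerSeries S.rawRing using () renaming (ring to S⟦X⟧; X to X′; const to const′)
  private
    module R⟦X⟧ = RingNotation R⟦X⟧
    module S⟦X⟧ = RingNotation S⟦X⟧

  map-const : ∀ a → (φ ∘ const a) S⟦X⟧.≈ const′ (φ a)
  map-const a zero    = S.refl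
  map-const a (suc n) = 0#-homo

  map-X : (φ ∘ X) S⟦X⟧.≈ X′
  map-X zero          = 0#-homo
  map-X (suc zero)    = 1#-homo
  map-X (suc (suc n)) = 0#-homo

  map-* : ∀ f g → (φ ∘ (f R⟦X⟧.* g)) S⟦X⟧.≈ (φ ∘ f) S⟦X⟧.* (φ ∘ g)
  map-* f g zero    = S.trans (+-homo _ _) (S.+-cong (*-homo _ _) 0#-homo)
  map-* f g (suc n) = S.trans (+-homo _ _) (S.+-cong (*-homo _ _) (map-* (f ∘ suc) g n))

  map-isHom : IsRingHomomorphism R⟦X⟧ S⟦X⟧ (φ ∘_)
  map-isHom = ringHomomorphism (PowerSeriesRing.commutativeRing R) (PowerSeriesRing.commutativeRing S) (φ ∘_)
    (λ eq n → ⟦⟧-cong (eq n))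
    (λ f g n → +-homo (f n) (g n))
    map-*
    (λ f n → -‿homo (f n))
    (λ n → S.trans (map-const R.0# n) (PowerSeriesRing.const-cong S 0#-homo n))
    (λ n → S.trans (map-const R.1# n) (PowerSeriesRing.const-cong S 1#-homo n))

module _ {c ℓ : Level} (R : CommutativeRing c ℓ) where
  private
    module R = CommutativeRing R
    module P = PowerSeriesRing R
  open PowerSeries R.rawRing using (const) renaming (ring to R⟦X⟧)

  const-isHom : IsRingHomomorphism R.rawRing R⟦X⟧ const
  const-isHom = ringHomomorphism R P.commutativeRing const P.const-cong
    (λ { a b zero → R.refl ; a b (suc n) → R.sym (R.+-identityʳ _) })
    (λ { a b zero → R.sym (P.const-* a (const b) 0) ; a b (suc n) → R.sym (R.trans (P.const-* a (const b) (suc n)) (R.zeroʳ a)) })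
    (λ { a zero → R.refl ; a (suc n) → R.sym ε⁻¹≈ε })
    (λ _ → R.refl) (λ _ → R.refl)
    where open import Algebra.Properties.Group R.+-group using (ε⁻¹≈ε)

-- Laurent series as power series over a power of X

module LaurentSeriesRing {c ℓ : Level} (R : CommutativeRing c ℓ) where
  private
    module R = CommutativeRing R
    module P = PowerSeriesRing R
  open PowerSeries R.rawRing using (X) renaming (ring to R⟦X⟧)
  open LaurentSeries R.rawRing renaming (ring to R⸨X⸩)
  private module L = RingNotation R⸨X⸩
  open CommutativeRing P.commutativeRing
  open import Algebra.Properties.Semiring.Exp semiring using (_^_; ^-homo-*)
  open IntegerSolver P.commutativeRing
  open import Relation.Binary.Reasoning.Setoid setoid

  private
    cross : ∀ a b c d {x y} → (X ^ a * X ^ b) * x ≈ (X ^ c * X ^ d) * y → X ^ (a ℕ.+ b) * x ≈ X ^ (c ℕ.+ d) * y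
    cross a b c d eq = trans (*-congʳ (^-homo-* X a b)) (trans eq (*-congʳ (sym (^-homo-* X c d))))

    -- Equality is cross-multiplication, so chaining two equations leaves the middle denominator
    -- `X ^ e` as a common factor; X is not a zero divisor, whatever the coefficient ring.
    ≈-trans : ∀ f g h → f L.≈ g → g L.≈ h → f L.≈ h
    ≈-trans (f /X^ d) (g /X^ e) (h /X^ k) p q = P.X^*-cancelˡ e (begin
      X ^ e * (X ^ k * f)   ≈⟨ swap (X ^ e) (X ^ k) f ⟩
      X ^ k * (X ^ e * f)   ≈⟨ *-congˡ {X ^ k} p ⟩
      X ^ k * (X ^ d * g)   ≈⟨ swap (X ^ k) (X ^ d) g ⟩
      X ^ d * (X ^ k * g)   ≈⟨ *-congˡ {X ^ d} q ⟩
      X ^ d * (X ^ e * h)   ≈⟨ swap (X ^ d) (X ^ e) h ⟩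
      X ^ e * (X ^ d * h)   ∎)
      where
      swap : ∀ a b x → a * (b * x) ≈ b * (a * x)
      swap = solve 3 (λ a b x → a :* (b :* x) := b :* (a :* x)) refl

    +-cong-≈ : ∀ f f′ g g′ → f L.≈ f′ → g L.≈ g′ → f L.+ g L.≈ f′ L.+ g′
    +-cong-≈ (f /X^ d) (f′ /X^ d′) (g /X^ e) (g′ /X^ e′) p q = cross d′ e′ d e (begin
      (X ^ d′ * X ^ e′) * (X ^ e * f + X ^ d * g)
        ≈⟨ expand (X ^ d′) (X ^ e′) (X ^ e) (X ^ d) f g ⟩
      (X ^ e * X ^ e′) * (X ^ d′ * f) + (X ^ d * X ^ d′) * (X ^ e′ * g)
        ≈⟨ +-cong (*-congˡ {X ^ e * X ^ e′} p) (*-congˡ {X ^ d * X ^ d′} q) ⟩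
      (X ^ e * X ^ e′) * (X ^ d * f′) + (X ^ d * X ^ d′) * (X ^ e * g′)
        ≈⟨ collect (X ^ d′) (X ^ e′) (X ^ e) (X ^ d) f′ g′ ⟩
      (X ^ d * X ^ e) * (X ^ e′ * f′ + X ^ d′ * g′) ∎)
      where
      expand : ∀ d′ e′ e d f g → (d′ * e′) * (e * f + d * g) ≈ (e * e′) * (d′ * f) + (d * d′) * (e′ * g)
      expand = solve 6 (λ d′ e′ e d f g → (d′ :* e′) :* (e :* f :+ d :* g) := (e :* e′) :* (d′ :* f) :+ (d :* d′) :* (e′ :* g)) refl
      collect : ∀ d′ e′ e d f g → (e * e′) * (d * f) + (d * d′) * (e * g) ≈ (d * e) * (e′ * f + d′ * g)
      collect = solve 6 (λ d′ e′ e d f g → (e :* e′) :* (d :* f) :+ (d :* d′) :* (e :* g) := (d :* e) :* (e′ :* f :+ d′ :* g)) refl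

    *-cong-≈ : ∀ f f′ g g′ → f L.≈ f′ → g L.≈ g′ → f L.* g L.≈ f′ L.* g′
    *-cong-≈ (f /X^ d) (f′ /X^ d′) (g /X^ e) (g′ /X^ e′) p q = cross d′ e′ d e (begin
      (X ^ d′ * X ^ e′) * (f * g)   ≈⟨ medial (X ^ d′) (X ^ e′) f g ⟩
      (X ^ d′ * f) * (X ^ e′ * g)   ≈⟨ *-cong p q ⟩
      (X ^ d * f′) * (X ^ e * g′)   ≈⟨ medial (X ^ d) (X ^ e) f′ g′ ⟨
      (X ^ d * X ^ e) * (f′ * g′)   ∎)
      where
      medial : ∀ a b f g → (a * b) * (f * g) ≈ (a * f) * (b * g)
      medial = solve 4 (λ a b f g → (a :* b) :* (f :* g) := (a :* f) :* (b :* g)) refl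

    +-assoc-≈ : ∀ f g h → (f L.+ g) L.+ h L.≈ f L.+ (g L.+ h)
    +-assoc-≈ (f /X^ d) (g /X^ e) (h /X^ k) =
      *-cong (reflexive (≡.cong (X ^_) (≡.sym (ℕ.+-assoc d e k)))) (begin
        X ^ k * (X ^ e * f + X ^ d * g) + X ^ (d ℕ.+ e) * h
          ≈⟨ +-congˡ (*-congʳ {h} (^-homo-* X d e)) ⟩
        X ^ k * (X ^ e * f + X ^ d * g) + (X ^ d * X ^ e) * h
          ≈⟨ solve 6 (λ k e d f g h → k :* (e :* f :+ d :* g) :+ (d :* e) :* h := (e :* k) :* f :+ d :* (k :* g :+ e :* h))
               refl (X ^ k) (X ^ e) (X ^ d) f g h ⟩
        (X ^ e * X ^ k) * f + X ^ d * (X ^ k * g + X ^ e * h)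
          ≈⟨ +-congʳ (*-congʳ {f} (^-homo-* X e k)) ⟨
        X ^ (e ℕ.+ k) * f + X ^ d * (X ^ k * g + X ^ e * h) ∎)

    +-comm-≈ : ∀ f g → f L.+ g L.≈ g L.+ f
    +-comm-≈ (f /X^ d) (g /X^ e) = *-cong (reflexive (≡.cong (X ^_) (ℕ.+-comm e d))) (+-comm (X ^ e * f) (X ^ d * g))

    +-identityˡ-≈ : ∀ f → L.0# L.+ f L.≈ f
    +-identityˡ-≈ (f /X^ d) = *-congˡ {X ^ d}
      (solve 2 (λ a f → a :* con 0ℤ :+ 𝟙 :* f := f) refl (X ^ d) f)

    -‿inverseˡ-≈ : ∀ f → (L.- f) L.+ f L.≈ L.0#
    -‿inverseˡ-≈ (f /X^ d) =
      solve 3 (λ a b f → 𝟙 :* (a :* (:- f) :+ a :* f) := b :* con 0ℤ) refl (X ^ d) (X ^ (d ℕ.+ d)) f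

    -‿cong-≈ : ∀ f g → f L.≈ g → L.- f L.≈ L.- g
    -‿cong-≈ (f /X^ d) (g /X^ e) p = begin
      X ^ e * - f     ≈⟨ neg (X ^ e) f ⟨
      - (X ^ e * f)   ≈⟨ -‿cong p ⟩
      - (X ^ d * g)   ≈⟨ neg (X ^ d) g ⟩
      X ^ d * - g     ∎
      where
      neg : ∀ a f → - (a * f) ≈ a * - f
      neg = solve 2 (λ a f → :- (a :* f) := a :* (:- f)) refl

    *-assoc-≈ : ∀ f g h → (f L.* g) L.* h L.≈ f L.* (g L.* h)
    *-assoc-≈ (f /X^ d) (g /X^ e) (h /X^ k) =
      *-cong (reflexive (≡.cong (X ^_) (≡.sym (ℕ.+-assoc d e k)))) (*-assoc f g h)

    *-comm-≈ : ∀ f g → f L.* g L.≈ g L.* f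
    *-comm-≈ (f /X^ d) (g /X^ e) = *-cong (reflexive (≡.cong (X ^_) (ℕ.+-comm e d))) (*-comm f g)

    *-identityˡ-≈ : ∀ f → L.1# L.* f L.≈ f
    *-identityˡ-≈ (f /X^ d) = *-congˡ {X ^ d} (*-identityˡ f)

    distribʳ-≈ : ∀ h f g → (f L.+ g) L.* h L.≈ f L.* h L.+ g L.* h
    distribʳ-≈ (h /X^ k) (f /X^ d) (g /X^ e) = begin
      X ^ ((d ℕ.+ k) ℕ.+ (e ℕ.+ k)) * ((X ^ e * f + X ^ d * g) * h)
        ≈⟨ *-congʳ {(X ^ e * f + X ^ d * g) * h} (^-homo-* X (d ℕ.+ k) (e ℕ.+ k)) ⟩
      (X ^ (d ℕ.+ k) * X ^ (e ℕ.+ k)) * ((X ^ e * f + X ^ d * g) * h)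
        ≈⟨ *-congʳ {(X ^ e * f + X ^ d * g) * h} (*-cong (^-homo-* X d k) (^-homo-* X e k)) ⟩
      ((X ^ d * X ^ k) * (X ^ e * X ^ k)) * ((X ^ e * f + X ^ d * g) * h)
        ≈⟨ solve 6 (λ d e k f g h →
             ((d :* k) :* (e :* k)) :* ((e :* f :+ d :* g) :* h) :=
             ((d :* e) :* k) :* ((e :* k) :* (f :* h) :+ (d :* k) :* (g :* h)))
             refl (X ^ d) (X ^ e) (X ^ k) f g h ⟩
      ((X ^ d * X ^ e) * X ^ k) * ((X ^ e * X ^ k) * (f * h) + (X ^ d * X ^ k) * (g * h))
        ≈⟨ *-cong (trans (^-homo-* X (d ℕ.+ e) k) (*-congʳ {X ^ k} (^-homo-* X d e)))
             (+-cong (*-congʳ {f * h} (^-homo-* X e k)) (*-congʳ {g * h} (^-homo-* X d k))) ⟨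
      X ^ ((d ℕ.+ e) ℕ.+ k) * (X ^ (e ℕ.+ k) * (f * h) + X ^ (d ℕ.+ k) * (g * h)) ∎

  commutativeRing : CommutativeRing c ℓ
  commutativeRing = record
    { RawRing R⸨X⸩
    ; isCommutativeRing = record
      { isRing = record
        { +-isAbelianGroup = record
          { isGroup = record
            { isMonoid = record
              { isSemigroup = record
                { isMagma = record
                  { isEquivalence = record
                    { refl  = λ { {f /X^ d} → refl {X ^ d * f} }
                    ; sym   = λ { {f /X^ d} {g /X^ e} → sym {X ^ e * f} {X ^ d * g} }
                    ; trans = λ {f} {g} {h} → ≈-trans f g h
                    }
                  ; ∙-cong = λ {f} {f′} {g} {g′} → +-cong-≈ f f′ g g′
                  }
                ; assoc = +-assoc-≈
                }
              ; identity = +-identityˡ-≈ , λ f → ≈-trans (f L.+ L.0#) (L.0# L.+ f) f (+-comm-≈ f L.0#) (+-identityˡ-≈ f)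
              }
            ; inverse = -‿inverseˡ-≈ , λ f → ≈-trans (f L.+ L.- f) (L.- f L.+ f) L.0# (+-comm-≈ f (L.- f)) (-‿inverseˡ-≈ f)
            ; ⁻¹-cong = λ {f} {g} → -‿cong-≈ f g
            }
          ; comm = +-comm-≈
          }
        ; *-cong     = λ {f} {f′} {g} {g′} → *-cong-≈ f f′ g g′
        ; *-assoc    = *-assoc-≈
        ; *-identity = *-identityˡ-≈ , λ f → ≈-trans (f L.* L.1#) (L.1# L.* f) f (*-comm-≈ f L.1#) (*-identityˡ-≈ f)
        ; distrib    = (λ f g h → ≈-trans (f L.* (g L.+ h)) ((g L.+ h) L.* f) (f L.* g L.+ f L.* h) (*-comm-≈ f (g L.+ h))
                         (≈-trans ((g L.+ h) L.* f) (g L.* f L.+ h L.* f) (f L.* g L.+ f L.* h) (distribʳ-≈ f g h)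
                           (+-cong-≈ (g L.* f) (f L.* g) (h L.* f) (f L.* h) (*-comm-≈ g f) (*-comm-≈ h f))))
                     , distribʳ-≈
        }
      ; *-comm = *-comm-≈
      }
    }

  fromSeries-isHom : IsRingHomomorphism R⟦X⟧ R⸨X⸩ fromSeries
  fromSeries-isHom = ringHomomorphism P.commutativeRing commutativeRing fromSeries
    (*-congˡ {1#})
    (λ f g → *-congˡ {1#} (solve 2 (λ f g → f :+ g := 𝟙 :* f :+ 𝟙 :* g) refl f g))
    (λ f g → refl {1# * (f * g)})
    (λ f → refl {1# * - f})
    (refl {1# * 0#}) (refl {1# * 1#})

  fromSeries-num : ∀ f d → fromSeries (X ^ d) L.* (f /X^ d) L.≈ fromSeries f
  fromSeries-num f d = *-identityˡ (X ^ d * f)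

-- The operations are parameters because conversion checking of closed expressions over ℚ⸨z⸩⟦u⟧ is infeasible
-- once the ring operations unfold, whereas two instances of a record are compared argument by argument.
module _ {c ℓ : Level} {C : Set c} (_≈_÷_ : C → C → C → Set ℓ) (_+_ _*_ _-_ : C → C → C) (-_ : C → C)
  (_^_ : C → ℕ → C) (1# : C) where

  record ClosedForms (u z r s F G : C) (m : ℕ) : Set ℓ where
    field
      F-closed : F ≈
        (- (u * (((u ^ m) * ((1# + ((z ^ 2) * u)) + (z * (u ^ 2))))
          - ((((r ^ (m ∸ 1)) * z) * (u + z)) * ((z + (r * (z ^ 2))) + (r ^ 2))))))
        ÷ (((z ^ 3) * (u - r)) * (u - s))
      G-closed : G ≈
        (((r ^ (m ∸ 1)) * ((z + (r ^ 2)) + ((z ^ 2) * r)))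
          - (((z * (u ^ (m ∸ 1))) * (1# + (z * u))) * ((1# + ((z ^ 2) * u)) + (z * (u ^ 2)))))
        ÷ (((z ^ 3) * (u - r)) * (u - s))

  record TotalClosedForm (z r T : C) (m : ℕ) : Set ℓ where
    field
      closed : T ≈
        ((((((z * (r ^ (m ∸ 1))) + ((z ^ 2) * (r ^ m))) + (r ^ suc m)) - (z ^ 2)) - z) - 1#)
        ÷ (((z ^ 2) + z) - 1#)

-- The kernel equation in an arbitrary commutative ring

module KernelAlgebra {c ℓ : Level} (R : CommutativeRing c ℓ) where
  open CommutativeRing R
  open RingNotation rawRing using (_^_; _≈_÷_)
  open IntegerSolver R
  open import Relation.Binary.Reasoning.Setoid setoid

  solves-quotient : ∀ x a b b⁻¹ → b * b⁻¹ ≈ 1# → x * b ≈ a → x ≈ a ÷ b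
  solves-quotient x a b b⁻¹ bb⁻¹≈1 xb≈a = b⁻¹ , bb⁻¹≈1 , (begin
    x               ≈⟨ *-identityʳ x ⟨
    x * 1#          ≈⟨ *-congˡ bb⁻¹≈1 ⟨
    x * (b * b⁻¹)   ≈⟨ *-assoc x b b⁻¹ ⟨
    x * b * b⁻¹     ≈⟨ *-congʳ xb≈a ⟩
    a * b⁻¹         ∎)

  -- Evaluation of u at a root is carried out as reduction modulo `u - ρ`; the cofactor `w` records
  -- the cost of replacing `u ^ n` by `ρ ^ n`.
  power-difference : ∀ x y n → ∃[ w ] x ^ n ≈ y ^ n + (x - y) * w
  power-difference x y zero    = 0# , solve 2 (λ x y → 𝟙 := 𝟙 :+ (x :- y) :* con 0ℤ) refl x y
  power-difference x y (suc n) with w , xⁿ≈ ← power-difference x y n = y ^ n + x * w , (begin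
    x * x ^ n
      ≈⟨ *-congˡ xⁿ≈ ⟩
    x * (y ^ n + (x - y) * w)
      ≈⟨ solve 4 (λ x y p w → x :* (p :+ (x :- y) :* w) := y :* p :+ (x :- y) :* (p :+ x :* w)) refl x y (y ^ n) w ⟩
    y * y ^ n + (x - y) * (y ^ n + x * w) ∎)

  -- The kernel z³u² - (1 - z² - z⁴) u + z³ of the functional equation factors as (u - ρ) (z³ u - t).
  record IsFactorisation (z ρ t : Carrier) : Set ℓ where
    constructor _,_
    field
      product : t * ρ ≈ z ^ 3
      sum     : t + z ^ 3 * ρ ≈ 1# - z ^ 4 - z ^ 2

  -- The value of c = f₋ₘ₊₁ forced by the root r of the kernel, where n = m - 1.
  record IsBoundaryValue (z r c : Carrier) (n : ℕ) : Set ℓ where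
    constructor boundary-value
    field equation : z * c ≈ r ^ n * (z + r ^ 2 + z ^ 2 * r)

  record TotalEquation (z c T : Carrier) : Set ℓ where
    constructor total-equation
    field equation : T + z * c ≈ 1# + z + z ^ 2 + (z + z ^ 2) * T

  -- T = Φ + Γ splits the paths by the direction of the last step, Γ̂ counts the empty path and the
  -- paths in Γ, and A and B count the paths in Φ that stay above the line after N̄ and after Ē.
  totalEquation : ∀ z c f T Φ Φ⁺ Γ Γ̂ A B →
    T ≈ Φ + Γ → Φ ≈ Φ⁺ + 1# → Γ̂ ≈ Γ + 1# →
    Φ⁺ ≈ z ^ 1 * Γ̂ + z ^ 2 * Γ̂ → Γ ≈ z ^ 1 * A + z ^ 2 * B →
    Φ ≈ A + (c + f) → Φ ≈ B + f → f ≈ 0# → TotalEquation z c T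
  totalEquation z c f T Φ Φ⁺ Γ Γ̂ A B T≈ Φ≈ Γ̂≈ Φ⁺≈ Γ≈ Φ≈A Φ≈B f≈0 = total-equation (begin
    T + z * c
      ≈⟨ +-congʳ (trans T≈ (+-cong (trans Φ≈ (+-congʳ Φ⁺≈)) Γ≈)) ⟩
    z ^ 1 * Γ̂ + z ^ 2 * Γ̂ + 1# + (z ^ 1 * A + z ^ 2 * B) + z * c
      -- Completing `A` and `B` to `Φ` takes `c + f` and `f`. The term `z * c` supplies the first
      -- summand, and the multiples of `f` are subtracted again.
      ≈⟨ solve 6 (λ z Γ̂ A B c f → z :^ 1 :* Γ̂ :+ z :^ 2 :* Γ̂ :+ 𝟙 :+ (z :^ 1 :* A :+ z :^ 2 :* B) :+ z :* c :=
           𝟙 :+ (z :+ z :^ 2) :* Γ̂ :+ z :* (A :+ (c :+ f)) :+ z :^ 2 :* (B :+ f) :- (z :+ z :^ 2) :* f) refl z Γ̂ A B c f ⟩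
    1# + (z + z ^ 2) * Γ̂ + z * (A + (c + f)) + z ^ 2 * (B + f) - (z + z ^ 2) * f
      ≈⟨ +-cong (+-cong (+-cong (+-congˡ (*-congˡ Γ̂≈)) (*-congˡ (sym Φ≈A))) (*-congˡ (sym Φ≈B))) (-‿cong (*-congˡ f≈0)) ⟩
    1# + (z + z ^ 2) * (Γ + 1#) + z * Φ + z ^ 2 * Φ - (z + z ^ 2) * 0#
      ≈⟨ solve 3 (λ z Γ Φ → 𝟙 :+ (z :+ z :^ 2) :* (Γ :+ 𝟙) :+ z :* Φ :+ z :^ 2 :* Φ :- (z :+ z :^ 2) :* con 0ℤ :=
           𝟙 :+ z :+ z :^ 2 :+ (z :+ z :^ 2) :* (Φ :+ Γ)) refl z Γ Φ ⟩
    1# + z + z ^ 2 + (z + z ^ 2) * (Φ + Γ)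
      ≈⟨ +-congˡ (*-congˡ T≈) ⟨
    1# + z + z ^ 2 + (z + z ^ 2) * T ∎)

  -- S counts the nonempty paths in F, and Ĝ counts the empty path and the paths in G.
  record FunctionalEquations (u z c F S Ĝ G : Carrier) (n : ℕ) : Set ℓ where
    field
      F≈ : F ≈ S + u ^ suc n
      Ĝ≈ : Ĝ ≈ G + u ^ suc n
      S≈ : S ≈ u * (u * (z * Ĝ)) + u * (z ^ 2 * Ĝ)
      G≈ : u * (u * G) + u * (z * c) ≈ z * F + u * (z ^ 2 * F)

  Cancels : Carrier → Set (c ⊔ ℓ)
  Cancels u = ∀ x y → u * x ≈ u * y → x ≈ y

  -- The two sides differ by `ρ` times the kernel at `ρ`, which is zero. This replaces a cubic in
  -- `ρ` by the quadratic that appears in the closed forms.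
  boundary : ∀ z ρ t → IsFactorisation z ρ t → z * (1# + z * ρ) * (1# + z ^ 2 * ρ + z * ρ ^ 2) ≈ z + ρ ^ 2 + z ^ 2 * ρ
  boundary z ρ t (tρ≈z³ , t+z³ρ≈) = begin
    z * (1# + z * ρ) * (1# + z ^ 2 * ρ + z * ρ ^ 2)
      ≈⟨ solve 2 (λ z ρ → z :* (𝟙 :+ z :* ρ) :* (𝟙 :+ z :^ 2 :* ρ :+ z :* ρ :^ 2) :=
           z :+ ρ :^ 2 :+ z :^ 2 :* ρ :+ ρ :* (z :^ 3 :+ z :^ 3 :* ρ :* ρ :- (𝟙 :- z :^ 4 :- z :^ 2) :* ρ)) refl z ρ ⟩
    z + ρ ^ 2 + z ^ 2 * ρ + ρ * (z ^ 3 + z ^ 3 * ρ * ρ - (1# - z ^ 4 - z ^ 2) * ρ)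
      ≈⟨ +-congˡ (*-congˡ (+-cong (+-congʳ tρ≈z³) (-‿cong (*-congʳ t+z³ρ≈)))) ⟨
    z + ρ ^ 2 + z ^ 2 * ρ + ρ * (t * ρ + z ^ 3 * ρ * ρ - (t + z ^ 3 * ρ) * ρ)
      ≈⟨ solve 3 (λ z ρ t → z :+ ρ :^ 2 :+ z :^ 2 :* ρ :+ ρ :* (t :* ρ :+ z :^ 3 :* ρ :* ρ :- (t :+ z :^ 3 :* ρ) :* ρ) :=
           z :+ ρ :^ 2 :+ z :^ 2 :* ρ) refl z ρ t ⟩
    z + ρ ^ 2 + z ^ 2 * ρ ∎

  -- The right side is the coefficient of `G` after `F` has been eliminated from the functional
  -- equations; the factorisation is Vieta's rule applied to it.
  kernel-expand : ∀ u z ρ t → IsFactorisation z ρ t → (u - ρ) * (z ^ 3 * u - t) ≈ (z + z ^ 2 * u) * (z * u + z ^ 2) - u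
  kernel-expand u z ρ t (tρ≈z³ , t+z³ρ≈) = begin
    (u - ρ) * (z ^ 3 * u - t)
      ≈⟨ solve 4 (λ u z ρ t → (u :- ρ) :* (z :^ 3 :* u :- t) := z :^ 3 :* u :* u :- (t :+ z :^ 3 :* ρ) :* u :+ t :* ρ) refl u z ρ t ⟩
    z ^ 3 * u * u - (t + z ^ 3 * ρ) * u + t * ρ
      ≈⟨ +-cong (+-congˡ (-‿cong (*-congʳ t+z³ρ≈))) tρ≈z³ ⟩
    z ^ 3 * u * u - (1# - z ^ 4 - z ^ 2) * u + z ^ 3
      ≈⟨ solve 2 (λ u z → z :^ 3 :* u :* u :- (𝟙 :- z :^ 4 :- z :^ 2) :* u :+ z :^ 3 := (z :+ z :^ 2 :* u) :* (z :* u :+ z :^ 2) :- u) refl u z ⟩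
    (z + z ^ 2 * u) * (z * u + z ^ 2) - u ∎

  kernel≈ : ∀ u z r s → z ^ 3 * (u - r) * (u - s) ≈ (u - r) * (z ^ 3 * u - z ^ 3 * s)
  kernel≈ = solve 4 (λ u z r s → z :^ 3 :* (u :- r) :* (u :- s) := (u :- r) :* (z :^ 3 :* u :- z :^ 3 :* s)) refl

  -- Isolates the constant term in u of the denominator. It is `z ^ 3` because the product of the
  -- roots is 1, so the denominator is a unit as soon as z is invertible.
  kernel-constantTerm : ∀ u z r s → IsFactorisation z r (z ^ 3 * s) →
    z ^ 3 * (u - r) * (u - s) ≈ z ^ 3 + u * (z ^ 3 * u + z ^ 2 + z ^ 4 - 1#)
  kernel-constantTerm u z r s factorisation = begin
    z ^ 3 * (u - r) * (u - s)               ≈⟨ kernel≈ u z r s ⟩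
    (u - r) * (z ^ 3 * u - z ^ 3 * s)       ≈⟨ kernel-expand u z r (z ^ 3 * s) factorisation ⟩
    (z + z ^ 2 * u) * (z * u + z ^ 2) - u   ≈⟨ solve 2 (λ u z → (z :+ z :^ 2 :* u) :* (z :* u :+ z :^ 2) :- u := z :^ 3 :+ u :* (z :^ 3 :* u :+ z :^ 2 :+ z :^ 4 :- 𝟙)) refl u z ⟩
    z ^ 3 + u * (z ^ 3 * u + z ^ 2 + z ^ 4 - 1#) ∎

  -- Serves over two rings: with power series coefficients to find the boundary value through
  -- `root-multiple`, and with Laurent coefficients, where the hypothesis `unit` of `Close` holds,
  -- to divide by the kernel.
  module Solve (u z c F S Ĝ G : Carrier) (n : ℕ) (equations : FunctionalEquations u z c F S Ĝ G n) (cancel : Cancels u) where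
    open FunctionalEquations equations

    private
      V : Carrier
      V = u ^ n

    F-equation : F ≈ u * (V * (1# + z ^ 2 * u + z * u ^ 2) + (z * u + z ^ 2) * G)
    F-equation = begin
      F ≈⟨ F≈ ⟩
      S + u * V ≈⟨ +-congʳ S≈ ⟩
      u * (u * (z * Ĝ)) + u * (z ^ 2 * Ĝ) + u * V
        ≈⟨ +-congʳ (+-cong (*-congˡ (*-congˡ (*-congˡ Ĝ≈))) (*-congˡ (*-congˡ Ĝ≈))) ⟩
      u * (u * (z * (G + u * V))) + u * (z ^ 2 * (G + u * V)) + u * V
        ≈⟨ solve 4 (λ u z V G → u :* (u :* (z :* (G :+ u :* V))) :+ u :* (z :^ 2 :* (G :+ u :* V)) :+ u :* V :=
             u :* (V :* (𝟙 :+ z :^ 2 :* u :+ z :* u :^ 2) :+ (z :* u :+ z :^ 2) :* G)) refl u z V G ⟩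
      u * (V * (1# + z ^ 2 * u + z * u ^ 2) + (z * u + z ^ 2) * G) ∎

    G-equation : u * G + z * c ≈ (z + z ^ 2 * u) * (V * (1# + z ^ 2 * u + z * u ^ 2) + (z * u + z ^ 2) * G)
    G-equation = cancel _ _ (begin
      u * (u * G + z * c) ≈⟨ distribˡ u (u * G) (z * c) ⟩
      u * (u * G) + u * (z * c) ≈⟨ G≈ ⟩
      z * F + u * (z ^ 2 * F) ≈⟨ +-cong (*-congˡ F-equation) (*-congˡ (*-congˡ F-equation)) ⟩
      z * (u * W) + u * (z ^ 2 * (u * W))
        ≈⟨ solve 3 (λ u z W → z :* (u :* W) :+ u :* (z :^ 2 :* (u :* W)) := u :* ((z :+ z :^ 2 :* u) :* W)) refl u z W ⟩
      u * ((z + z ^ 2 * u) * W) ∎)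
      where
      W : Carrier
      W = V * (1# + z ^ 2 * u + z * u ^ 2) + (z * u + z ^ 2) * G

    module _ (ρ t : Carrier) (factorisation : IsFactorisation z ρ t) where
      kernel-G : (u - ρ) * (z ^ 3 * u - t) * G ≈ z * c - z * V * (1# + z * u) * (1# + z ^ 2 * u + z * u ^ 2)
      kernel-G = begin
        (u - ρ) * (z ^ 3 * u - t) * G
          ≈⟨ *-congʳ (kernel-expand u z ρ t factorisation) ⟩
        ((z + z ^ 2 * u) * (z * u + z ^ 2) - u) * G
          ≈⟨ solve 5 (λ u z V c G → ((z :+ z :^ 2 :* u) :* (z :* u :+ z :^ 2) :- u) :* G :=
               (z :+ z :^ 2 :* u) :* (V :* (𝟙 :+ z :^ 2 :* u :+ z :* u :^ 2) :+ (z :* u :+ z :^ 2) :* G)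
               :- u :* G :- z :* V :* (𝟙 :+ z :* u) :* (𝟙 :+ z :^ 2 :* u :+ z :* u :^ 2)) refl u z V c G ⟩
        (z + z ^ 2 * u) * (V * (1# + z ^ 2 * u + z * u ^ 2) + (z * u + z ^ 2) * G)
          - u * G - z * V * (1# + z * u) * (1# + z ^ 2 * u + z * u ^ 2)
          ≈⟨ +-congʳ (+-congʳ G-equation) ⟨
        u * G + z * c - u * G - z * V * (1# + z * u) * (1# + z ^ 2 * u + z * u ^ 2)
          ≈⟨ +-congʳ (solve 2 (λ x y → x :+ y :- x := y) refl (u * G) (z * c)) ⟩
        z * c - z * V * (1# + z * u) * (1# + z ^ 2 * u + z * u ^ 2) ∎

      -- kernel-G with the right-hand side evaluated at u = ρ, which changes it by a multiple of u - ρ.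
      root-multiple : ∃[ A ] (u - ρ) * A ≈ z * c - ρ ^ n * (z + ρ ^ 2 + z ^ 2 * ρ)
      root-multiple with w , uⁿ≈ ← power-difference u ρ n =
        (z ^ 3 * u - t) * G + w * B + ρ ^ n * q , (begin
        (u - ρ) * ((z ^ 3 * u - t) * G + w * B + ρ ^ n * q)
          ≈⟨ solve 8 (λ u ρ z t G w p c →
               let B = z :* (𝟙 :+ z :* u) :* (𝟙 :+ z :^ 2 :* u :+ z :* u :^ 2)
                   q = z :* (z :+ z :^ 2 :+ (z :+ z :^ 3) :* (u :+ ρ) :+ z :^ 2 :* (u :* u :+ u :* ρ :+ ρ :* ρ)) in
               (u :- ρ) :* ((z :^ 3 :* u :- t) :* G :+ w :* B :+ p :* q) :=
               (u :- ρ) :* (z :^ 3 :* u :- t) :* G :+ (p :+ (u :- ρ) :* w) :* B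
                 :- p :* (z :* (𝟙 :+ z :* ρ) :* (𝟙 :+ z :^ 2 :* ρ :+ z :* ρ :^ 2))) refl u ρ z t G w (ρ ^ n) c ⟩
        (u - ρ) * (z ^ 3 * u - t) * G + (ρ ^ n + (u - ρ) * w) * B
          - ρ ^ n * (z * (1# + z * ρ) * (1# + z ^ 2 * ρ + z * ρ ^ 2))
          ≈⟨ +-cong (+-cong kernel-G (*-congʳ (sym uⁿ≈))) (-‿cong (*-congˡ (boundary z ρ t factorisation))) ⟩
        z * c - z * V * (1# + z * u) * (1# + z ^ 2 * u + z * u ^ 2) + V * B - ρ ^ n * (z + ρ ^ 2 + z ^ 2 * ρ)
          ≈⟨ +-congʳ (solve 4 (λ u z V x → x :- z :* V :* (𝟙 :+ z :* u) :* (𝟙 :+ z :^ 2 :* u :+ z :* u :^ 2)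
               :+ V :* (z :* (𝟙 :+ z :* u) :* (𝟙 :+ z :^ 2 :* u :+ z :* u :^ 2)) := x) refl u z V (z * c)) ⟩
        z * c - ρ ^ n * (z + ρ ^ 2 + z ^ 2 * ρ) ∎)
        where
        B q : Carrier
        B = z * (1# + z * u) * (1# + z ^ 2 * u + z * u ^ 2)
        -- The divided difference of `B`: as `B` is `z * (1# + (z + z ^ 2) * u + (z + z ^ 3) * u ^ 2
        -- + z ^ 2 * u ^ 3)`, the product `(u - ρ) * q` is `B` minus its value at `u = ρ`.
        q = z * (z + z ^ 2 + (z + z ^ 3) * (u + ρ) + z ^ 2 * (u * u + u * ρ + ρ * ρ))

    module Close (r s : Carrier) (factorisation : IsFactorisation z r (z ^ 3 * s))
      (boundaryValue : IsBoundaryValue z r c n) (unit : ∀ y → ∃[ w ] (z ^ 3 + u * y) * w ≈ 1#) where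
      private
        P K : Carrier
        P = 1# + z ^ 2 * u + z * u ^ 2
        K = z ^ 3 * (u - r) * (u - s)

      G-closed : G * K ≈ r ^ n * (z + r ^ 2 + z ^ 2 * r) - z * u ^ n * (1# + z * u) * P
      G-closed = begin
        G * K                                               ≈⟨ *-comm G K ⟩
        K * G                                               ≈⟨ *-congʳ (kernel≈ u z r s) ⟩
        (u - r) * (z ^ 3 * u - z ^ 3 * s) * G               ≈⟨ kernel-G r (z ^ 3 * s) factorisation ⟩
        z * c - z * u ^ n * (1# + z * u) * P                ≈⟨ +-congʳ (IsBoundaryValue.equation boundaryValue) ⟩
        r ^ n * (z + r ^ 2 + z ^ 2 * r) - z * u ^ n * (1# + z * u) * P ∎

      F-closed : F * K ≈ - (u * (u ^ suc n * P - r ^ n * z * (u + z) * (z + r * z ^ 2 + r ^ 2)))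
      F-closed = begin
        F * K
          ≈⟨ *-congʳ F-equation ⟩
        u * (u ^ n * P + (z * u + z ^ 2) * G) * K
          ≈⟨ solve 6 (λ u v P z G K → u :* (v :* P :+ (z :* u :+ z :^ 2) :* G) :* K := u :* (v :* P :* K :+ (z :* u :+ z :^ 2) :* (G :* K)))
               refl u (u ^ n) P z G K ⟩
        u * (u ^ n * P * K + (z * u + z ^ 2) * (G * K))
          ≈⟨ *-congˡ (+-cong (*-congˡ (trans (kernel≈ u z r s) (kernel-expand u z r (z ^ 3 * s) factorisation))) (*-congˡ G-closed)) ⟩
        u * (u ^ n * P * ((z + z ^ 2 * u) * (z * u + z ^ 2) - u) +
          (z * u + z ^ 2) * (r ^ n * (z + r ^ 2 + z ^ 2 * r) - z * u ^ n * (1# + z * u) * P))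
          -- Because `z + z ^ 2 * u` is `z * (1# + z * u)`, the two multiples of
          -- `v * P * (z * u + z ^ 2)` cancel, leaving only `- (u * v * P)` from the kernel.
          ≈⟨ solve 6 (λ u v P z r p →
               u :* (v :* P :* ((z :+ z :^ 2 :* u) :* (z :* u :+ z :^ 2) :- u) :+
                 (z :* u :+ z :^ 2) :* (p :* (z :+ r :^ 2 :+ z :^ 2 :* r) :- z :* v :* (𝟙 :+ z :* u) :* P)) :=
               :- (u :* (u :* v :* P :- p :* z :* (u :+ z) :* (z :+ r :* z :^ 2 :+ r :^ 2)))) refl u (u ^ n) P z r (r ^ n) ⟩
        - (u * (u ^ suc n * P - r ^ n * z * (u + z) * (z + r * z ^ 2 + r ^ 2))) ∎

      closedForms : ClosedForms _≈_÷_ _+_ _*_ _-_ -_ _^_ 1# u z r s F G (suc n)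
      closedForms = record
        { F-closed = solves-quotient _ _ _ w K*w≈1 F-closed
        ; G-closed = solves-quotient _ _ _ w K*w≈1 G-closed
        }
        where
        y w : Carrier
        y = z ^ 3 * u + z ^ 2 + z ^ 4 - 1#
        w = let w , _ = unit y in w

        K*w≈1 : K * w ≈ 1#
        K*w≈1 = let _ , eq = unit y in trans (*-congʳ (kernel-constantTerm u z r s factorisation)) eq

  totalClosedForm : ∀ z r c T n → IsBoundaryValue z r c n → TotalEquation z c T →
    ∃[ w ] (z ^ 2 + z - 1#) * w ≈ 1# → TotalClosedForm _≈_÷_ _+_ _*_ _-_ -_ _^_ 1# z r T (suc n)
  totalClosedForm z r c T n (boundary-value c≈) (total-equation T≈) (w , eq) = record { closed = solves-quotient _ _ _ w eq (begin
    T * (z ^ 2 + z - 1#)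
      ≈⟨ solve 3 (λ z T c → T :* (z :^ 2 :+ z :- 𝟙) := 𝟙 :+ z :+ z :^ 2 :+ (z :+ z :^ 2) :* T :- T :- 𝟙 :- z :- z :^ 2) refl z T c ⟩
    1# + z + z ^ 2 + (z + z ^ 2) * T - T - 1# - z - z ^ 2
      ≈⟨ +-congʳ (+-congʳ (+-congʳ (+-congʳ T≈))) ⟨
    T + z * c - T - 1# - z - z ^ 2
      ≈⟨ +-congʳ (+-congʳ (+-congʳ (+-congʳ (+-congˡ c≈)))) ⟩
    T + r ^ n * (z + r ^ 2 + z ^ 2 * r) - T - 1# - z - z ^ 2
      ≈⟨ solve 4 (λ T p z r → T :+ p :* (z :+ r :^ 2 :+ z :^ 2 :* r) :- T :- 𝟙 :- z :- z :^ 2 :=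
           z :* p :+ z :^ 2 :* (r :* p) :+ r :* (r :* p) :- z :^ 2 :- z :- 𝟙) refl T (r ^ n) z r ⟩
    z * r ^ n + z ^ 2 * r ^ suc n + r ^ suc (suc n) - z ^ 2 - z - 1# ∎) }

  -- The numerators of r and s, with ½ as h.
  roots-sum : ∀ h a d → h + h ≈ 1# → h * (a - d) + h * (a + d) ≈ a
  roots-sum h a d h+h≈1 = begin
    h * (a - d) + h * (a + d)   ≈⟨ solve 3 (λ h a d → h :* (a :- d) :+ h :* (a :+ d) := (h :+ h) :* a) refl h a d ⟩
    (h + h) * a                 ≈⟨ *-congʳ h+h≈1 ⟩
    1# * a                      ≈⟨ *-identityˡ a ⟩
    a                           ∎

  roots-product : ∀ h x d → h + h ≈ 1# →
    d * d ≈ x ^ 8 - (1# + 1#) * x ^ 6 - x ^ 4 - (1# + 1#) * x ^ 2 + 1# →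
    h * (1# - x ^ 4 - x ^ 2 - d) * (h * (1# - x ^ 4 - x ^ 2 + d)) ≈ x ^ 6
  roots-product h x d h+h≈1 d²≈Δ = begin
    h * (1# - x ^ 4 - x ^ 2 - d) * (h * (1# - x ^ 4 - x ^ 2 + d))
      ≈⟨ solve 3 (λ h a d → h :* (a :- d) :* (h :* (a :+ d)) := h :* h :* (a :* a :- d :* d)) refl h (1# - x ^ 4 - x ^ 2) d ⟩
    h * h * ((1# - x ^ 4 - x ^ 2) * (1# - x ^ 4 - x ^ 2) - d * d)
      ≈⟨ *-congˡ (+-congˡ (-‿cong d²≈Δ)) ⟩
    h * h * ((1# - x ^ 4 - x ^ 2) * (1# - x ^ 4 - x ^ 2) - (x ^ 8 - (1# + 1#) * x ^ 6 - x ^ 4 - (1# + 1#) * x ^ 2 + 1#))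
      -- The square of `1# - x ^ 4 - x ^ 2` exceeds Δ by four times `x ^ 6`. The factor 4 is
      -- absorbed by the two halves, and `x ^ 6` matches the denominators of r and s, giving r s =
      -- 1.
      ≈⟨ solve 2 (λ h x → h :* h :* ((𝟙 :- x :^ 4 :- x :^ 2) :* (𝟙 :- x :^ 4 :- x :^ 2)
             :- (x :^ 8 :- (𝟙 :+ 𝟙) :* x :^ 6 :- x :^ 4 :- (𝟙 :+ 𝟙) :* x :^ 2 :+ 𝟙)) :=
           (h :+ h) :* (h :+ h) :* x :^ 6) refl h x ⟩
    (h + h) * (h + h) * x ^ 6
      ≈⟨ *-congʳ (*-cong h+h≈1 h+h≈1) ⟩
    1# * 1# * x ^ 6
      ≈⟨ trans (*-congʳ (*-identityˡ 1#)) (*-identityˡ (x ^ 6)) ⟩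
    x ^ 6 ∎

module PowerSeriesProperties {c ℓ : Level} (R : CommutativeRing c ℓ) where
  open CommutativeRing R
  open PowerSeries rawRing using (X) renaming (Series to Seq; ring to R⟦X⟧)
  open PowerSeriesRing R using (X*-zero; X*-suc)
  private module S = RingNotation R⟦X⟧

  X^-same : ∀ n → (X S.^ n) n ≈ 1#
  X^-same zero    = refl
  X^-same (suc n) = trans (X*-suc (X S.^ n) n) (X^-same n)

  X^-other : ∀ n {k} → k ≢ n → (X S.^ n) k ≈ 0#
  X^-other zero    {zero}  k≢n with () ← k≢n ≡.refl
  X^-other zero    {suc k} k≢n = refl
  X^-other (suc n) {zero}  k≢n = X*-zero (X S.^ n)
  X^-other (suc n) {suc k} k≢n = trans (X*-suc (X S.^ n) k) (X^-other n (k≢n ∘ ≡.cong suc))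

-- Substitution of the small root

module KernelMethod {c ℓ : Level} (R : CommutativeRing c ℓ) where
  private
    module R⟦z⟧ = PowerSeriesRing R
    module R⟦z⟧⟦u⟧ = PowerSeriesRing R⟦z⟧.commutativeRing
    module Z = CommutativeRing R⟦z⟧.commutativeRing
    module U = CommutativeRing R⟦z⟧⟦u⟧.commutativeRing
    module Z^ = RingNotation Z.rawRing
    module U^ = RingNotation U.rawRing
  open PowerSeries (CommutativeRing.rawRing R) using () renaming (X to z)
  open PowerSeries Z.rawRing using (const) renaming (X to u)

  -- If u = ρ(z) is a root of the kernel without constant term, it can be substituted into
  -- (u - ρ) A = e: the coefficients satisfy A k = ρ A (k + 1), so every power of z divides them.
  substitute-root : ∀ σ e A → (u U.- const (z Z.* σ)) U.* A U.≈ const e → e Z.≈ Z.0#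
  substitute-root σ e A eq = begin
    e                              ≈⟨ eq 0 ⟨
    ((u U.- const ρ) U.* A) 0      ≈⟨ coefficient 0 ⟩
    (u U.* A) 0 Z.- ρ Z.* A 0      ≈⟨ Z.+-cong (R⟦z⟧⟦u⟧.X*-zero A) (Z.-‿cong (Z.trans (Z.*-congˡ {ρ} A₀≈0) (Z.zeroʳ ρ))) ⟩
    Z.0# Z.- Z.0#                  ≈⟨ Z.-‿inverseʳ Z.0# ⟩
    Z.0#                           ∎
    where
    open import Relation.Binary.Reasoning.Setoid Z.setoid
    open import Algebra.Properties.Ring U.ring using ([y-z]x≈yx-zx)
    open import Algebra.Properties.Group Z.+-group using (x∙y⁻¹≈ε⇒x≈y)

    ρ : Z.Carrier
    ρ = z Z.* σ

    coefficient : ∀ k → ((u U.- const ρ) U.* A) k Z.≈ (u U.* A) k Z.- ρ Z.* A k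
    coefficient k = Z.trans ([y-z]x≈yx-zx A u (const ρ) k) (Z.+-congˡ {(u U.* A) k} (Z.-‿cong (R⟦z⟧⟦u⟧.const-* ρ A k)))

    shift : ∀ k → A k Z.≈ ρ Z.* A (suc k)
    shift k = x∙y⁻¹≈ε⇒x≈y (A k) (ρ Z.* A (suc k)) (begin
      A k Z.- ρ Z.* A (suc k)                      ≈⟨ Z.+-congʳ (R⟦z⟧⟦u⟧.X*-suc A k) ⟨
      (u U.* A) (suc k) Z.- ρ Z.* A (suc k)        ≈⟨ coefficient (suc k) ⟨
      ((u U.- const ρ) U.* A) (suc k)              ≈⟨ eq (suc k) ⟩
      Z.0#                                         ∎)

    -- Induction on the degree in z for all `k` at once: since `ρ` is `z Z.* σ`, coefficient `suc j`
    -- of `A k` combines coefficients of `A (suc k)` of degree at most `j`. The bound `n` makes all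
    -- these lower degrees available.
    vanish : ∀ n k j → j ℕ.≤ n → CommutativeRing._≈_ R (A k j) (CommutativeRing.0# R)
    vanish n k zero    _         = CR.trans (shift k 0) (CR.trans (Z.*-assoc z σ (A (suc k)) 0) (R⟦z⟧.X*-zero (σ Z.* A (suc k))))
      where module CR = CommutativeRing R
    vanish (suc n) k (suc j) (ℕ.s≤s j≤n) = CR.trans (shift k (suc j)) (CR.trans (Z.*-assoc z σ (A (suc k)) (suc j))
      (CR.trans (R⟦z⟧.X*-suc (σ Z.* A (suc k)) j)
        (CR.trans (R⟦z⟧.*-comm-≈ σ (A (suc k)) j) (R⟦z⟧.*-vanish (A (suc k)) σ j λ i i≤j → vanish n (suc k) i (ℕ.≤-trans i≤j j≤n)))))
      where module CR = CommutativeRing R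

    A₀≈0 : A 0 Z.≈ Z.0#
    A₀≈0 zero    = vanish 0 0 0 ℕ.≤-refl
    A₀≈0 (suc n) = vanish (suc n) 0 (suc n) ℕ.≤-refl

-- Transport of the equations along ring homomorphisms

module Transport {c ℓ c′ ℓ′ : Level} (R : CommutativeRing c ℓ) (S : CommutativeRing c′ ℓ′)
  (φ : CommutativeRing.Carrier R → CommutativeRing.Carrier S)
  (φ-hom : IsRingHomomorphism (CommutativeRing.rawRing R) (CommutativeRing.rawRing S) φ) where
  private
    module R where
      open CommutativeRing R public
      open RingNotation rawRing public using (_^_)
    module S where
      open CommutativeRing S public
      open RingNotation rawRing public using (_^_)
    module KR = KernelAlgebra R
    module KS = KernelAlgebra S
  open HomProperties R S φ-hom

  infix 4 _↦_
  -- The combinators below follow the syntax of a term, so that the image of an expression is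
  -- written with the shape of the expression itself; `carry` then moves an equation.
  _↦_ : R.Carrier → S.Carrier → Set ℓ′
  x ↦ y = φ x S.≈ y

  infixl 6 _⊕_ _⊝_
  infixl 7 _⊗_
  infixr 8 _⊛_

  _⊕_ : ∀ {x y x′ y′} → x ↦ x′ → y ↦ y′ → x R.+ y ↦ x′ S.+ y′
  p ⊕ q = S.trans (+-homo _ _) (S.+-cong p q)

  _⊝_ : ∀ {x y x′ y′} → x ↦ x′ → y ↦ y′ → x R.- y ↦ x′ S.- y′
  p ⊝ q = p ⊕ S.trans (-‿homo _) (S.-‿cong q)

  _⊗_ : ∀ {x y x′ y′} → x ↦ x′ → y ↦ y′ → x R.* y ↦ x′ S.* y′
  p ⊗ q = S.trans (*-homo _ _) (S.*-cong p q)

  _⊛_ : ∀ {x x′} → x ↦ x′ → ∀ n → x R.^ n ↦ x′ S.^ n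
  p ⊛ zero  = 1#-homo
  p ⊛ suc n = p ⊗ p ⊛ n

  carry : ∀ {x y x′ y′} → x R.≈ y → x ↦ x′ → y ↦ y′ → x′ S.≈ y′
  carry x≈y p q = S.trans (S.sym p) (S.trans (⟦⟧-cong x≈y) q)

  factorisation-map : ∀ z ρ t z′ ρ′ t′ → z ↦ z′ → ρ ↦ ρ′ → t ↦ t′ →
    KR.IsFactorisation z ρ t → KS.IsFactorisation z′ ρ′ t′
  factorisation-map _ _ _ _ _ _ z ρ t factorisation = record
    { product = carry product (t ⊗ ρ) (z ⊛ 3)
    ; sum     = carry sum (t ⊕ z ⊛ 3 ⊗ ρ) (1#-homo ⊝ z ⊛ 4 ⊝ z ⊛ 2)
    }
    where open KR.IsFactorisation factorisation

  boundary-map : ∀ z r c z′ r′ c′ n → z ↦ z′ → r ↦ r′ → c ↦ c′ →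
    KR.IsBoundaryValue z r c n → KS.IsBoundaryValue z′ r′ c′ n
  boundary-map _ _ _ _ _ _ n z r c boundaryValue = record
    { equation = carry equation (z ⊗ c) (r ⊛ n ⊗ (z ⊕ r ⊛ 2 ⊕ z ⊛ 2 ⊗ r)) }
    where open KR.IsBoundaryValue boundaryValue

  -- Folds an expression in images into the image of one element. For the embedding of constants
  -- this yields the `const e` that `substitute-root` requires.
  boundary-difference : ∀ z r c n →
    φ z S.* φ c S.- φ r S.^ n S.* (φ z S.+ φ r S.^ 2 S.+ φ z S.^ 2 S.* φ r)
      S.≈ φ (z R.* c R.- r R.^ n R.* (z R.+ r R.^ 2 R.+ z R.^ 2 R.* r))
  boundary-difference z r c n = S.sym (S.refl ⊗ S.refl ⊝ S.refl ⊛ n ⊗ (S.refl ⊕ S.refl ⊛ 2 ⊕ S.refl ⊛ 2 ⊗ S.refl))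

  functionalEquations-map : ∀ u z c F S Ĝ G n u′ z′ c′ → u ↦ u′ → z ↦ z′ → c ↦ c′ →
    KR.FunctionalEquations u z c F S Ĝ G n → KS.FunctionalEquations u′ z′ c′ (φ F) (φ S) (φ Ĝ) (φ G) n
  functionalEquations-map _ _ _ F S Ĝ G n _ _ _ u z c equations = record
    { F≈ = carry F≈ S.refl (S.refl {φ S} ⊕ u ⊛ suc n)
    ; Ĝ≈ = carry Ĝ≈ S.refl (S.refl {φ G} ⊕ u ⊛ suc n)
    ; S≈ = carry S≈ S.refl (u ⊗ (u ⊗ (z ⊗ S.refl)) ⊕ u ⊗ (z ⊛ 2 ⊗ S.refl))
    ; G≈ = carry G≈ (u ⊗ (u ⊗ S.refl) ⊕ u ⊗ (z ⊗ c)) (z ⊗ S.refl ⊕ u ⊗ (z ⊛ 2 ⊗ S.refl))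
    }
    where open KR.FunctionalEquations equations

  totalEquation-map : ∀ z c T z′ c′ → z ↦ z′ → c ↦ c′ → KR.TotalEquation z c T → KS.TotalEquation z′ c′ (φ T)
  totalEquation-map _ _ _ _ _ z c totalEquation = record
    { equation = carry equation (S.refl ⊕ z ⊗ c) (1#-homo ⊕ z ⊕ z ⊛ 2 ⊕ (z ⊕ z ⊛ 2) ⊗ S.refl) }
    where open KR.TotalEquation totalEquation

  inverse-map : ∀ z z′ → z ↦ z′ →
    ∃[ w ] (z R.^ 2 R.+ z R.- R.1#) R.* w R.≈ R.1# → ∃[ w ] (z′ S.^ 2 S.+ z′ S.- S.1#) S.* w S.≈ S.1#
  inverse-map _ _ z (w , eq) = φ w , carry eq ((z ⊛ 2 ⊕ z ⊝ 1#-homo) ⊗ S.refl) 1#-homo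

-- From the recurrences to the closed forms

module Solution {c ℓ : Level} (R : CommutativeRing c ℓ) where
  private
    module R⟦z⟧ = PowerSeriesRing R
    module R⸨z⸩ = LaurentSeriesRing R
    module R⟦z⟧⟦u⟧ = PowerSeriesRing R⟦z⟧.commutativeRing
    module R⸨z⸩⟦u⟧ = PowerSeriesRing R⸨z⸩.commutativeRing
    module Z where
      open CommutativeRing R⟦z⟧.commutativeRing public
      open RingNotation rawRing public using (_^_)
    module L where
      open CommutativeRing R⸨z⸩.commutativeRing public
      open RingNotation rawRing public using (_^_; _≈_÷_)
    module ZU where
      open CommutativeRing R⟦z⟧⟦u⟧.commutativeRing public
      open RingNotation rawRing public using (_^_)
    module LU where
      open CommutativeRing R⸨z⸩⟦u⟧.commutativeRing public
      open RingNotation rawRing public using (_^_; _≈_÷_)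
    module ZK = KernelAlgebra R⟦z⟧.commutativeRing
    module LK = KernelAlgebra R⸨z⸩.commutativeRing
    module ZUK = KernelAlgebra R⟦z⟧⟦u⟧.commutativeRing
    module LUK = KernelAlgebra R⸨z⸩⟦u⟧.commutativeRing
    module ZU-const = PowerSeries Z.rawRing
    module LU-const = PowerSeries L.rawRing
    module Z→ZU = Transport R⟦z⟧.commutativeRing R⟦z⟧⟦u⟧.commutativeRing ZU-const.const (const-isHom R⟦z⟧.commutativeRing)
    module L→LU = Transport R⸨z⸩.commutativeRing R⸨z⸩⟦u⟧.commutativeRing LU-const.const (const-isHom R⸨z⸩.commutativeRing)
  open LaurentSeries (CommutativeRing.rawRing R) using (fromSeries; _/X^_)
  open PowerSeries (CommutativeRing.rawRing R) using () renaming (X to z)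
  private
    module Z→L = Transport R⟦z⟧.commutativeRing R⸨z⸩.commutativeRing fromSeries R⸨z⸩.fromSeries-isHom
    module Z→L-hom = HomProperties R⟦z⟧.commutativeRing R⸨z⸩.commutativeRing R⸨z⸩.fromSeries-isHom
    module ZU→LU = Transport R⟦z⟧⟦u⟧.commutativeRing R⸨z⸩⟦u⟧.commutativeRing (fromSeries ∘_) Z→L-hom.map-isHom
    module L→LU-hom = HomProperties R⸨z⸩.commutativeRing R⸨z⸩⟦u⟧.commutativeRing (const-isHom R⸨z⸩.commutativeRing)
    u ζ : ZU.Carrier
    u = ZU-const.X
    ζ = ZU-const.const z

    z′ : L.Carrier
    z′ = fromSeries z

    u′ ζ′ : LU.Carrier
    u′ = LU-const.X
    ζ′ = LU-const.const z′

  -- ν₋ /X^ 3 and ν₊ /X^ 3 are the roots r and s.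
  module _ (h d : Z.Carrier) (h+h≈1 : h Z.+ h Z.≈ Z.1#)
    (d²≈Δ : d Z.* d Z.≈ z Z.^ 8 Z.- (Z.1# Z.+ Z.1#) Z.* z Z.^ 6 Z.- z Z.^ 4 Z.- (Z.1# Z.+ Z.1#) Z.* z Z.^ 2 Z.+ Z.1#)
    where
    ν₋ ν₊ : Z.Carrier
    ν₋ = h Z.* (Z.1# Z.- z Z.^ 4 Z.- z Z.^ 2 Z.- d)
    ν₊ = h Z.* (Z.1# Z.- z Z.^ 4 Z.- z Z.^ 2 Z.+ d)

    module _ (ν₊⁻¹ : Z.Carrier) (ν₊ν₊⁻¹≈1 : ν₊ Z.* ν₊⁻¹ Z.≈ Z.1#) where
      private
        r s : L.Carrier
        r = ν₋ /X^ 3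
        s = ν₊ /X^ 3

        -- `ρ` is r as a power series: as `ν₋ Z.* ν₊` is `z Z.^ 6`, the quotient of `ν₋` by z³
        -- equals z³ times `ν₊⁻¹`. One factor z is kept in front to display the vanishing constant
        -- term.
        σ ρ : Z.Carrier
        σ = z Z.^ 2 Z.* ν₊⁻¹
        ρ = z Z.* σ

        ρ≈ : ρ Z.≈ z Z.^ 3 Z.* ν₊⁻¹
        ρ≈ = Z.sym (Z.*-assoc z (z Z.^ 2) ν₊⁻¹)

        z³ρ≈ν₋ : z Z.^ 3 Z.* ρ Z.≈ ν₋
        z³ρ≈ν₋ = begin
          z Z.^ 3 Z.* ρ                            ≈⟨ Z.*-congˡ {z Z.^ 3} ρ≈ ⟩
          z Z.^ 3 Z.* (z Z.^ 3 Z.* ν₊⁻¹)           ≈⟨ Z.*-assoc (z Z.^ 3) (z Z.^ 3) ν₊⁻¹ ⟨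
          z Z.^ 3 Z.* z Z.^ 3 Z.* ν₊⁻¹             ≈⟨ Z.*-congʳ {ν₊⁻¹} (^-homo-* z 3 3) ⟨
          z Z.^ 6 Z.* ν₊⁻¹                         ≈⟨ Z.*-congʳ {ν₊⁻¹} (ZK.roots-product h z d h+h≈1 d²≈Δ) ⟨
          ν₋ Z.* ν₊ Z.* ν₊⁻¹                       ≈⟨ Z.*-assoc ν₋ ν₊ ν₊⁻¹ ⟩
          ν₋ Z.* (ν₊ Z.* ν₊⁻¹)                     ≈⟨ Z.*-congˡ {ν₋} ν₊ν₊⁻¹≈1 ⟩
          ν₋ Z.* Z.1#                              ≈⟨ Z.*-identityʳ ν₋ ⟩
          ν₋                                       ∎
          where
          open import Relation.Binary.Reasoning.Setoid Z.setoid
          open import Algebra.Properties.Semiring.Exp Z.semiring using (^-homo-*)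

        factorisation : ZK.IsFactorisation z ρ ν₊
        factorisation = record { product = begin
          ν₊ Z.* ρ                          ≈⟨ Z.*-congˡ {ν₊} ρ≈ ⟩
          ν₊ Z.* (z Z.^ 3 Z.* ν₊⁻¹)         ≈⟨ x∙yz≈y∙xz ν₊ (z Z.^ 3) ν₊⁻¹ ⟩
          z Z.^ 3 Z.* (ν₊ Z.* ν₊⁻¹)         ≈⟨ Z.*-congˡ {z Z.^ 3} ν₊ν₊⁻¹≈1 ⟩
          z Z.^ 3 Z.* Z.1#                  ≈⟨ Z.*-identityʳ (z Z.^ 3) ⟩
          z Z.^ 3                           ∎ ; sum = begin
          ν₊ Z.+ z Z.^ 3 Z.* ρ              ≈⟨ Z.+-congˡ {ν₊} z³ρ≈ν₋ ⟩
          ν₊ Z.+ ν₋                         ≈⟨ Z.+-comm ν₊ ν₋ ⟩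
          ν₋ Z.+ ν₊                         ≈⟨ ZK.roots-sum h (Z.1# Z.- z Z.^ 4 Z.- z Z.^ 2) d h+h≈1 ⟩
          Z.1# Z.- z Z.^ 4 Z.- z Z.^ 2      ∎ }
          where
          open import Relation.Binary.Reasoning.Setoid Z.setoid
          open import Algebra.Properties.CommutativeSemigroup Z.*-commutativeSemigroup using (x∙yz≈y∙xz)

        ρ↦r : fromSeries ρ L.≈ r
        ρ↦r = Z.trans z³ρ≈ν₋ (Z.sym (Z.*-identityˡ ν₋))

        ν₊↦z³s : fromSeries ν₊ L.≈ z′ L.^ 3 L.* s
        ν₊↦z³s = L.trans {fromSeries ν₊} {fromSeries (z Z.^ 3) L.* s} {z′ L.^ 3 L.* s}
          (L.sym {fromSeries (z Z.^ 3) L.* s} {fromSeries ν₊} (R⸨z⸩.fromSeries-num ν₊ 3))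
          (L.*-congʳ {s} {fromSeries (z Z.^ 3)} {z′ L.^ 3} (Z→L-hom.^-homo z 3))

        L-factorisation : LK.IsFactorisation z′ r (z′ L.^ 3 L.* s)
        L-factorisation = Z→L.factorisation-map z ρ ν₊ z′ r (z′ L.^ 3 L.* s)
          (L.refl {z′}) ρ↦r ν₊↦z³s factorisation

        LU-factorisation : LUK.IsFactorisation ζ′ (LU-const.const r) (ζ′ LU.^ 3 LU.* LU-const.const s)
        LU-factorisation = L→LU.factorisation-map z′ r (z′ L.^ 3 L.* s) ζ′ (LU-const.const r) (ζ′ LU.^ 3 LU.* LU-const.const s)
          (LU.refl {ζ′}) (LU.refl {LU-const.const r})
          (LU.trans {LU-const.const (z′ L.^ 3 L.* s)} {LU-const.const (z′ L.^ 3) LU.* LU-const.const s} {ζ′ LU.^ 3 LU.* LU-const.const s}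
            (L→LU-hom.*-homo (z′ L.^ 3) s)
            (LU.*-congʳ {LU-const.const s} {LU-const.const (z′ L.^ 3)} {ζ′ LU.^ 3} (L→LU-hom.^-homo z′ 3)))
          L-factorisation

      -- The index of a coefficient is the height above the line y = -m with m = `suc n`. The origin
      -- has height `suc n`, so the empty path contributes exactly there.
      module Paths (n : ℕ) (F S Ĝ G : ZU.Carrier) (T : Z.Carrier)
        (F-same : F (suc n) Z.≈ S (suc n) Z.+ Z.1#) (F-other : ∀ {k} → k ≢ suc n → F k Z.≈ S k)
        (Ĝ-same : Ĝ (suc n) Z.≈ G (suc n) Z.+ Z.1#) (Ĝ-other : ∀ {k} → k ≢ suc n → Ĝ k Z.≈ G k)
        (S-zero : S 0 Z.≈ Z.0#) (S-one : S 1 Z.≈ z Z.^ 2 Z.* Ĝ 0)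
        (S-suc : ∀ k → S (2 ℕ.+ k) Z.≈ z Z.^ 1 Z.* Ĝ k Z.+ z Z.^ 2 Z.* Ĝ (1 ℕ.+ k))
        (G-rec : ∀ k → G k Z.≈ z Z.^ 1 Z.* F (2 ℕ.+ k) Z.+ z Z.^ 2 Z.* F (1 ℕ.+ k))
        (totalEquation : ZK.TotalEquation z (F 1) T)
        where

        private
          module ZP = PowerSeriesProperties R⟦z⟧.commutativeRing
          open import Relation.Binary.Reasoning.Setoid Z.setoid

          shifted : ∀ A B → A (suc n) Z.≈ B (suc n) Z.+ Z.1# → (∀ {k} → k ≢ suc n → A k Z.≈ B k) → A ZU.≈ B ZU.+ u ZU.^ suc n
          shifted A B same other k with k ℕ.≟ suc n
          ... | yes ≡.refl = Z.trans same (Z.+-congˡ {B (suc n)} (Z.sym (ZP.X^-same (suc n))))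
          ... | no  k≢     = Z.trans (other k≢) (Z.trans (Z.sym (Z.+-identityʳ (B k))) (Z.+-congˡ {B k} (Z.sym (ZP.X^-other (suc n) k≢))))

          ζ* : ∀ A k → (ζ ZU.* A) k Z.≈ z Z.^ 1 Z.* A k
          ζ* A k = Z.trans (R⟦z⟧⟦u⟧.const-* z A k) (Z.*-congʳ {A k} (Z.sym (Z.*-identityʳ z)))

          ζ²* : ∀ A k → (ζ ZU.^ 2 ZU.* A) k Z.≈ z Z.^ 2 Z.* A k
          ζ²* A k = Z.trans (ZU.*-congʳ {A} (ZU.sym (HomProperties.^-homo R⟦z⟧.commutativeRing R⟦z⟧⟦u⟧.commutativeRing (const-isHom R⟦z⟧.commutativeRing) z 2)) k)
            (R⟦z⟧⟦u⟧.const-* (z Z.^ 2) A k)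

          S≈ : S ZU.≈ u ZU.* (u ZU.* (ζ ZU.* Ĝ)) ZU.+ u ZU.* (ζ ZU.^ 2 ZU.* Ĝ)
          S≈ zero = begin
            S 0 ≈⟨ S-zero ⟩
            Z.0# ≈⟨ Z.+-identityʳ Z.0# ⟨
            Z.0# Z.+ Z.0# ≈⟨ Z.+-cong (R⟦z⟧⟦u⟧.X*-zero (u ZU.* (ζ ZU.* Ĝ))) (R⟦z⟧⟦u⟧.X*-zero (ζ ZU.^ 2 ZU.* Ĝ)) ⟨
            (u ZU.* (u ZU.* (ζ ZU.* Ĝ)) ZU.+ u ZU.* (ζ ZU.^ 2 ZU.* Ĝ)) 0 ∎
          S≈ (suc zero) = begin
            S 1 ≈⟨ S-one ⟩
            z Z.^ 2 Z.* Ĝ 0 ≈⟨ Z.+-identityˡ (z Z.^ 2 Z.* Ĝ 0) ⟨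
            Z.0# Z.+ z Z.^ 2 Z.* Ĝ 0 ≈⟨ Z.+-cong (R⟦z⟧⟦u⟧.X*-zero (ζ ZU.* Ĝ)) (ζ²* Ĝ 0) ⟨
            (u ZU.* (ζ ZU.* Ĝ)) 0 Z.+ (ζ ZU.^ 2 ZU.* Ĝ) 0 ≈⟨ Z.+-cong (R⟦z⟧⟦u⟧.X*-suc (u ZU.* (ζ ZU.* Ĝ)) 0) (R⟦z⟧⟦u⟧.X*-suc (ζ ZU.^ 2 ZU.* Ĝ) 0) ⟨
            (u ZU.* (u ZU.* (ζ ZU.* Ĝ)) ZU.+ u ZU.* (ζ ZU.^ 2 ZU.* Ĝ)) 1 ∎
          S≈ (suc (suc k)) = begin
            S (2 ℕ.+ k) ≈⟨ S-suc k ⟩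
            z Z.^ 1 Z.* Ĝ k Z.+ z Z.^ 2 Z.* Ĝ (1 ℕ.+ k) ≈⟨ Z.+-cong (ζ* Ĝ k) (ζ²* Ĝ (1 ℕ.+ k)) ⟨
            (ζ ZU.* Ĝ) k Z.+ (ζ ZU.^ 2 ZU.* Ĝ) (1 ℕ.+ k)
              ≈⟨ Z.+-cong (Z.trans (R⟦z⟧⟦u⟧.X*-suc (u ZU.* (ζ ZU.* Ĝ)) (suc k)) (R⟦z⟧⟦u⟧.X*-suc (ζ ZU.* Ĝ) k)) (R⟦z⟧⟦u⟧.X*-suc (ζ ZU.^ 2 ZU.* Ĝ) (suc k)) ⟨
            (u ZU.* (u ZU.* (ζ ZU.* Ĝ)) ZU.+ u ZU.* (ζ ZU.^ 2 ZU.* Ĝ)) (2 ℕ.+ k) ∎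

          F₀≈0 : F 0 Z.≈ Z.0#
          F₀≈0 = Z.trans (F-other λ ()) S-zero

          zero-*F₀ : ∀ x → x Z.* F 0 Z.≈ Z.0#
          zero-*F₀ x = Z.trans (Z.*-congˡ {x} F₀≈0) (Z.zeroʳ x)

          f₁ : ZU.Carrier
          f₁ = ZU-const.const (F 1)

          -- Down-steps lower the height by 2 or 1, so the recurrence for `G` divides by u² and u.
          -- After multiplication by u², the right side has a term `z Z.^ 1 Z.* F 1` in degree one
          -- with no counterpart in `G`; `f₁` accounts for it, while `F 0` vanishes.
          G≈ : u ZU.* (u ZU.* G) ZU.+ u ZU.* (ζ ZU.* f₁) ZU.≈ ζ ZU.* F ZU.+ u ZU.* (ζ ZU.^ 2 ZU.* F)
          G≈ zero = Z.+-cong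
            (Z.trans (R⟦z⟧⟦u⟧.X*-zero (u ZU.* G)) (Z.sym (Z.trans (ζ* F 0) (zero-*F₀ (z Z.^ 1)))))
            (Z.trans (R⟦z⟧⟦u⟧.X*-zero (ζ ZU.* f₁)) (Z.sym (R⟦z⟧⟦u⟧.X*-zero (ζ ZU.^ 2 ZU.* F))))
          G≈ (suc zero) = begin
            (u ZU.* (u ZU.* G)) 1 Z.+ (u ZU.* (ζ ZU.* f₁)) 1
              ≈⟨ Z.+-cong (Z.trans (R⟦z⟧⟦u⟧.X*-suc (u ZU.* G) 0) (R⟦z⟧⟦u⟧.X*-zero G)) (Z.trans (R⟦z⟧⟦u⟧.X*-suc (ζ ZU.* f₁) 0) (ζ* f₁ 0)) ⟩
            Z.0# Z.+ z Z.^ 1 Z.* F 1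
              ≈⟨ Z.+-comm Z.0# (z Z.^ 1 Z.* F 1) ⟩
            z Z.^ 1 Z.* F 1 Z.+ Z.0#
              ≈⟨ Z.+-cong (ζ* F 1) (Z.trans (R⟦z⟧⟦u⟧.X*-suc (ζ ZU.^ 2 ZU.* F) 0) (Z.trans (ζ²* F 0) (zero-*F₀ (z Z.^ 2)))) ⟨
            (ζ ZU.* F) 1 Z.+ (u ZU.* (ζ ZU.^ 2 ZU.* F)) 1 ∎
          G≈ (suc (suc k)) = begin
            (u ZU.* (u ZU.* G)) (2 ℕ.+ k) Z.+ (u ZU.* (ζ ZU.* f₁)) (2 ℕ.+ k)
              ≈⟨ Z.+-cong (Z.trans (R⟦z⟧⟦u⟧.X*-suc (u ZU.* G) (suc k)) (R⟦z⟧⟦u⟧.X*-suc G k))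
                   (Z.trans (R⟦z⟧⟦u⟧.X*-suc (ζ ZU.* f₁) (suc k)) (Z.trans (ζ* f₁ (suc k)) (Z.zeroʳ (z Z.^ 1)))) ⟩
            G k Z.+ Z.0#
              ≈⟨ Z.+-identityʳ (G k) ⟩
            G k
              ≈⟨ G-rec k ⟩
            z Z.^ 1 Z.* F (2 ℕ.+ k) Z.+ z Z.^ 2 Z.* F (1 ℕ.+ k)
              ≈⟨ Z.+-cong (ζ* F (2 ℕ.+ k)) (Z.trans (R⟦z⟧⟦u⟧.X*-suc (ζ ZU.^ 2 ZU.* F) (suc k)) (ζ²* F (suc k))) ⟨
            (ζ ZU.* F) (2 ℕ.+ k) Z.+ (u ZU.* (ζ ZU.^ 2 ZU.* F)) (2 ℕ.+ k) ∎

          equations : ZUK.FunctionalEquations u ζ f₁ F S Ĝ G n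
          equations = record
            { F≈ = shifted F S F-same F-other
            ; Ĝ≈ = shifted Ĝ G Ĝ-same Ĝ-other
            ; S≈ = S≈
            ; G≈ = G≈
            }

          -- Proved over power series with `ρ` in place of r, where divisibility by all powers of z
          -- forces zero. Only the resulting identity passes to Laurent series, where `ρ` becomes r.
          Z-boundary : ZK.IsBoundaryValue z ρ (F 1) n
          Z-boundary = record { equation = x∙y⁻¹≈ε⇒x≈y (z Z.* F 1) C
            (KernelMethod.substitute-root R σ (z Z.* F 1 Z.- C) A
              (ZU.trans {(u ZU.- ZU-const.const ρ) ZU.* A} A≈ (Z→ZU.boundary-difference z ρ (F 1) n))) }
            where
            open import Algebra.Properties.Group Z.+-group using (x∙y⁻¹≈ε⇒x≈y)
            C : Z.Carrier
            C = ρ Z.^ n Z.* (z Z.+ ρ Z.^ 2 Z.+ z Z.^ 2 Z.* ρ)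
            multiple : ∃[ A ] _
            multiple = ZUK.Solve.root-multiple u ζ f₁ F S Ĝ G n equations (λ x y → R⟦z⟧⟦u⟧.X*-cancelˡ {x} {y})
              (ZU-const.const ρ) (ZU-const.const ν₊)
              (Z→ZU.factorisation-map z ρ ν₊ ζ (ZU-const.const ρ) (ZU-const.const ν₊)
                (ZU.refl {ζ}) (ZU.refl {ZU-const.const ρ}) (ZU.refl {ZU-const.const ν₊}) factorisation)
            A : ZU.Carrier
            A = let A , _ = multiple in A
            A≈ = let _ , eq = multiple in eq

          L-boundary : LK.IsBoundaryValue z′ r (fromSeries (F 1)) n
          L-boundary = Z→L.boundary-map z ρ (F 1) z′ r (fromSeries (F 1)) n
            (L.refl {z′}) ρ↦r (L.refl {fromSeries (F 1)}) Z-boundary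

          r̂ ŝ f̂₁ : LU.Carrier
          r̂ = LU-const.const r
          ŝ = LU-const.const s
          f̂₁ = LU-const.const (fromSeries (F 1))

          LU-boundary : LUK.IsBoundaryValue ζ′ r̂ f̂₁ n
          LU-boundary = L→LU.boundary-map z′ r (fromSeries (F 1)) ζ′ r̂ f̂₁ n (LU.refl {ζ′}) (LU.refl {r̂}) (LU.refl {f̂₁}) L-boundary

          LU-equations : LUK.FunctionalEquations u′ ζ′ f̂₁ (fromSeries ∘ F) (fromSeries ∘ S) (fromSeries ∘ Ĝ) (fromSeries ∘ G) n
          LU-equations = ZU→LU.functionalEquations-map u ζ f₁ F S Ĝ G n u′ ζ′ f̂₁
            Z→L-hom.map-X (Z→L-hom.map-const z) (Z→L-hom.map-const (F 1)) equations

          -- The constant term in u is z³ whatever `y` is, and `Z.1# /X^ 3` inverts it; this is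
          -- where Laurent coefficients are indispensable.
          unit : ∀ y → ∃[ w ] (ζ′ LU.^ 3 LU.+ u′ LU.* y) LU.* w LU.≈ LU.1#
          unit y = R⸨z⸩⟦u⟧.inverse K (Z.1# /X^ 3)
            (L.trans {K 0 L.* (Z.1# /X^ 3)} {fromSeries (z Z.^ 3) L.* (Z.1# /X^ 3)} {L.1#}
              (L.*-congʳ {Z.1# /X^ 3} {K 0} {fromSeries (z Z.^ 3)}
                (L.trans {K 0} {z′ L.^ 3} {fromSeries (z Z.^ 3)} K₀≈z³
                  (L.sym {fromSeries (z Z.^ 3)} {z′ L.^ 3} (Z→L-hom.^-homo z 3))))
              (R⸨z⸩.fromSeries-num Z.1# 3))
            where
            K : LU.Carrier
            K = ζ′ LU.^ 3 LU.+ u′ LU.* y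

            K₀≈z³ : K 0 L.≈ z′ L.^ 3
            K₀≈z³ = L.trans {(ζ′ LU.^ 3) 0 L.+ (u′ LU.* y) 0} {z′ L.^ 3 L.+ L.0#} {z′ L.^ 3}
              (L.+-cong {(ζ′ LU.^ 3) 0} {z′ L.^ 3} {(u′ LU.* y) 0} {L.0#}
                (L.sym {z′ L.^ 3} {(ζ′ LU.^ 3) 0} (L→LU-hom.^-homo z′ 3 0)) (R⸨z⸩⟦u⟧.X*-zero y))
              (L.+-identityʳ (z′ L.^ 3))

          w-inverse : ∃[ w ] (z Z.^ 2 Z.+ z Z.- Z.1#) Z.* w Z.≈ Z.1#
          w-inverse = R⟦z⟧.inverse (z Z.^ 2 Z.+ z Z.- Z.1#) (CR.- CR.1#) (CR.trans (CR.*-congʳ w₀≈-1) -1*-1≈1)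
            where
            module CR = CommutativeRing R
            open IntegerSolver R using (solve; _:*_; :-_; _:=_; 𝟙)
            w₀≈-1 : (z Z.^ 2 Z.+ z Z.- Z.1#) 0 CR.≈ CR.- CR.1#
            w₀≈-1 = CR.trans (CR.+-congʳ (CR.trans (CR.+-identityʳ _) (R⟦z⟧.X*-zero (z Z.^ 1)))) (CR.+-identityˡ (CR.- CR.1#))
            -1*-1≈1 : (CR.- CR.1#) CR.* (CR.- CR.1#) CR.≈ CR.1#
            -1*-1≈1 = solve 0 ((:- 𝟙) :* (:- 𝟙) := 𝟙) CR.refl

        closedForms : ClosedForms LU._≈_÷_ LU._+_ LU._*_ LU._-_ (LU.-_) LU._^_ LU.1# u′ ζ′ r̂ ŝ (fromSeries ∘ F) (fromSeries ∘ G) (suc n)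
        closedForms = LUK.Solve.Close.closedForms u′ ζ′ f̂₁ (fromSeries ∘ F) (fromSeries ∘ S) (fromSeries ∘ Ĝ) (fromSeries ∘ G) n
          LU-equations (λ x y → R⸨z⸩⟦u⟧.X*-cancelˡ {x} {y}) r̂ ŝ LU-factorisation LU-boundary unit

        totalClosedForm : TotalClosedForm L._≈_÷_ L._+_ L._*_ L._-_ (L.-_) L._^_ L.1# z′ r (fromSeries T) (suc n)
        totalClosedForm = LK.totalClosedForm z′ r (fromSeries (F 1)) (fromSeries T) n L-boundary
          (Z→L.totalEquation-map z (F 1) T z′ (fromSeries (F 1)) (L.refl {z′}) (L.refl {fromSeries (F 1)}) totalEquation)
          (Z→L.inverse-map z z′ (L.refl {z′}) w-inverse)

-- Counting paths by their last step

open import Defs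
open import Data.Empty using (⊥-elim)
open import Data.Fin.Base using (toℕ)
open import Data.List.Base using (List; []; _∷_; _∷ʳ_; map; filter; inits; last; length; initLast; _∷ʳ′_)
open import Data.List.Membership.Propositional using (_∈_)
open import Data.List.Membership.Propositional.Properties
  using (∈-map⁺; ∈-map⁻; ∈-++⁺ˡ; ∈-++⁺ʳ; ∈-++⁻; ∈-filter⁺; ∈-filter⁻)
open import Data.List.Membership.Propositional.Properties.WithK using (unique∧set⇒bag)
import Data.List.Properties as List
open import Data.List.Relation.Binary.BagAndSetEquality using (∼bag⇒↭)
open import Data.List.Relation.Binary.Permutation.Propositional.Properties using (↭-length)
open import Data.List.Relation.Unary.All using (All; []; _∷_)
import Data.List.Relation.Unary.All as All
import Data.List.Relation.Unary.All.Properties as All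
open import Data.List.Relation.Unary.AllPairs using ([]; _∷_)
open import Data.List.Relation.Unary.Any using (here; there)
open import Data.List.Relation.Unary.Linked using (Linked; []; [-]; _∷_)
open import Data.List.Relation.Unary.Unique.Propositional using (Unique)
import Data.List.Relation.Unary.Unique.Propositional.Properties as Unique
open import Data.Maybe.Relation.Unary.All using (just; nothing) renaming (All to MaybeAll)
import Data.Maybe.Relation.Unary.All as MaybeAll
open import Data.Maybe.Relation.Unary.Any using (just) renaming (Any to MaybeAny)
import Data.Maybe.Relation.Unary.Any as MaybeAny
open import Data.Rational.Base as ℚ using (ℚ; 0ℚ; ½; 1ℚ)
import Data.Rational.Properties as ℚ
import Data.Rational.Unnormalised.Base as ℚᵘ
import Data.Rational.Unnormalised.Properties as ℚᵘ
open import Data.Sum.Base using (_⊎_; inj₁; inj₂; [_,_]′)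
open import Data.Unit.Base using (⊤; tt)
open import Function.Bundles using (_⇔_; mk⇔; module Equivalence)
open import Relation.Binary.Definitions using (tri<; tri≈; tri>)
open import Relation.Binary.PropositionalEquality using (refl; sym; trans; cong; cong₂; subst)
open import Relation.Unary using (Pred; Decidable)

open Equivalence using (to; from)

private variable
  P Q R : Pred Path 0ℓ

module _ (P? : Decidable P) (n : ℕ) where
  counted-unique : Unique (filter P? (pathsOfSize n))
  counted-unique = Unique.filter⁺ P? (pathsOfSize-unique n)

  ∈-counted : ∀ p → p ∈ filter P? (pathsOfSize n) ⇔ (size p ≡ n × P p)
  ∈-counted p = mk⇔
    (λ p∈ → let p∈paths , Pp = ∈-filter⁻ P? p∈ in size-pathsOfSize n p∈paths , Pp)
    (λ { (refl , Pp) → ∈-filter⁺ P? (∈-pathsOfSize p) Pp })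

-- Two duplicate-free lists with the same members are permutations of each other. Every identity
-- between counts is thereby reduced to exhibiting a duplicate-free enumeration.
count-enumeration : (P? : Decidable P) (n : ℕ) {ps : List Path} → Unique ps →
  (∀ p → p ∈ ps ⇔ (size p ≡ n × P p)) → count P? n ≡ length ps
count-enumeration P? n unique members =
  ↭-length (∼bag⇒↭ (unique∧set⇒bag (counted-unique P? n) unique
    (λ {p} → mk⇔ (from (members p) ∘ to (∈-counted P? n p)) (from (∈-counted P? n p) ∘ to (members p)))))

-- The equivalence is demanded at size `n` only; evaluation at u = 1 relies on this, because its
-- bound on the altitude depends on the size.
count-cong : (P? : Decidable P) (Q? : Decidable Q) (n : ℕ) →
  (∀ p → size p ≡ n → P p ⇔ Q p) → count P? n ≡ count Q? n
count-cong P? Q? n P⇔Q = count-enumeration P? n (counted-unique Q? n) λ p → mk⇔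
  (λ p∈ → let size≡n , Qp = to (∈-counted Q? n p) p∈ in size≡n , from (P⇔Q p size≡n) Qp)
  (λ { (size≡n , Pp) → from (∈-counted Q? n p) (size≡n , to (P⇔Q p size≡n) Pp) })

count-∅ : (P? : Decidable P) (n : ℕ) → (∀ p → ¬ P p) → count P? n ≡ 0
count-∅ P? n ¬P = count-enumeration P? n {[]} [] λ p → mk⇔ (λ ()) λ { (_ , Pp) → ⊥-elim (¬P p Pp) }

count-⊎ : (P? : Decidable P) (Q? : Decidable Q) (R? : Decidable R) (n : ℕ) →
  (∀ p → P p ⇔ (Q p ⊎ R p)) → (∀ p → ¬ (Q p × R p)) → count P? n ≡ count Q? n ℕ.+ count R? n
count-⊎ P? Q? R? n P⇔Q⊎R disjoint = trans
  (count-enumeration P? n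
    (Unique.++⁺ (counted-unique Q? n) (counted-unique R? n) λ {p} (p∈ , p∈′) →
      disjoint p (proj₂ (to (∈-counted Q? n p) p∈) , proj₂ (to (∈-counted R? n p) p∈′)))
    λ p → mk⇔
      (λ p∈ → [ map₂ (from (P⇔Q⊎R p) ∘ inj₁) ∘ to (∈-counted Q? n p)
              , map₂ (from (P⇔Q⊎R p) ∘ inj₂) ∘ to (∈-counted R? n p) ]′ (∈-++⁻ _ p∈))
      λ { (size≡n , Pp) → [ (λ Qp → ∈-++⁺ˡ (from (∈-counted Q? n p) (size≡n , Qp)))
                          , (λ Rp → ∈-++⁺ʳ _ (from (∈-counted R? n p) (size≡n , Rp))) ]′ (to (P⇔Q⊎R p) Pp) })
  (List.length-++ (filter Q? (pathsOfSize n)))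

size-∷ʳ : ∀ p e → size (p ∷ʳ e) ≡ Δx e ℕ.+ size p
size-∷ʳ []      e = refl
size-∷ʳ (d ∷ p) e = trans (cong (Δx d ℕ.+_) (size-∷ʳ p e)) (swap (Δx d) (Δx e) (size p))
  where open import Algebra.Properties.CommutativeSemigroup ℕ.+-commutativeSemigroup using () renaming (x∙yz≈y∙xz to swap)

-- The paths that reach size `n` with a further step of width `d`. There are none if `n` is less
-- than `d`, where truncated subtraction would wrongly offer the empty path.
pathsBefore : ℕ → ℕ → List Path
pathsBefore zero    n       = pathsOfSize n
pathsBefore (suc d) zero    = []
pathsBefore (suc d) (suc n) = pathsBefore d n

pathsBefore-unique : ∀ d n → Unique (pathsBefore d n)
pathsBefore-unique zero    n       = pathsOfSize-unique n
pathsBefore-unique (suc d) zero    = []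
pathsBefore-unique (suc d) (suc n) = pathsBefore-unique d n

∈-pathsBefore : ∀ d n p → p ∈ pathsBefore d n ⇔ d ℕ.+ size p ≡ n
∈-pathsBefore zero    n       p = mk⇔ (size-pathsOfSize n) λ { refl → ∈-pathsOfSize p }
∈-pathsBefore (suc d) zero    p = mk⇔ (λ ()) (λ ())
∈-pathsBefore (suc d) (suc n) p = mk⇔ (cong suc ∘ to (∈-pathsBefore d n p)) (from (∈-pathsBefore d n p) ∘ ℕ.suc-injective)

countBefore : ℕ → Decidable P → ℕ → ℕ
countBefore d P? n = length (filter P? (pathsBefore d n))

-- Appending a fixed step is injective, and the extensions by `d` and by `e` are disjoint since
-- `d ≢ e`. Their concatenation is thus an enumeration; `pathsOfSize` grows paths at the front and
-- does not unfold along last steps.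
count-lastStep : (P? : Decidable P) (Q? : Decidable Q) (R? : Decidable R) (d e : Step) → d ≢ e → (n : ℕ) →
  (∀ p → P p ⇔ ((∃[ q ] p ≡ q ∷ʳ d × Q q) ⊎ (∃[ q ] p ≡ q ∷ʳ e × R q))) →
  count P? n ≡ countBefore (Δx d) Q? n ℕ.+ countBefore (Δx e) R? n
count-lastStep {P} {Q} {R} P? Q? R? d e d≢e n decompose = trans
  (count-enumeration P? n
    (Unique.++⁺ (unique Q? d) (unique R? e) λ (p∈ , p∈′) → disjoint (∈-map⁻ _ p∈ , ∈-map⁻ _ p∈′))
    λ p → mk⇔
      (λ p∈ → [ (λ p∈ → let q , size≡n , p≡ , Qq = to (members Q? d p) p∈ in size≡n , from (decompose p) (inj₁ (q , p≡ , Qq)))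
              , (λ p∈ → let q , size≡n , p≡ , Rq = to (members R? e p) p∈ in size≡n , from (decompose p) (inj₂ (q , p≡ , Rq)))
              ]′ (∈-++⁻ _ p∈))
      λ { (size≡n , Pp) → [ (λ { (q , p≡ , Qq) → ∈-++⁺ˡ (from (members Q? d p) (q , size≡n , p≡ , Qq)) })
                          , (λ { (q , p≡ , Rq) → ∈-++⁺ʳ _ (from (members R? e p) (q , size≡n , p≡ , Rq)) })
                          ]′ (to (decompose p) Pp) })
  (trans (List.length-++ (extensions Q? d)) (cong₂ ℕ._+_ (List.length-map (_∷ʳ d) (filter Q? (pathsBefore (Δx d) n))) (List.length-map (_∷ʳ e) (filter R? (pathsBefore (Δx e) n)))))
  where
  extensions : {S : Pred Path 0ℓ} → Decidable S → Step → List Path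
  extensions S? e = map (_∷ʳ e) (filter S? (pathsBefore (Δx e) n))

  unique : {S : Pred Path 0ℓ} (S? : Decidable S) (e : Step) → Unique (extensions S? e)
  unique S? e = Unique.map⁺ (λ {p} {q} → List.∷ʳ-injectiveˡ p q) (Unique.filter⁺ S? (pathsBefore-unique (Δx e) n))

  members : {S : Pred Path 0ℓ} (S? : Decidable S) (e : Step) (p : Path) →
    p ∈ extensions S? e ⇔ (∃[ q ] size p ≡ n × p ≡ q ∷ʳ e × S q)
  members S? e p = mk⇔
    (λ p∈ → let q , q∈ , p≡ = ∈-map⁻ _ p∈ ; q∈before , Sq = ∈-filter⁻ S? q∈ in
      q , trans (cong size p≡) (trans (size-∷ʳ q e) (to (∈-pathsBefore (Δx e) n q) q∈before)) , p≡ , Sq)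
    λ { (q , size≡n , refl , Sq) →
      ∈-map⁺ (_∷ʳ e) (∈-filter⁺ S? (from (∈-pathsBefore (Δx e) n q) (trans (sym (size-∷ʳ q e)) size≡n)) Sq) }

  disjoint : ∀ {p qs rs} → ¬ ((∃[ q ] q ∈ qs × p ≡ q ∷ʳ d) × (∃[ r ] r ∈ rs × p ≡ r ∷ʳ e))
  disjoint ((q , _ , p≡) , (r , _ , p≡′)) = d≢e (List.∷ʳ-injectiveʳ q r (trans (sym p≡) p≡′))

altitude-∷ʳ : ∀ p e → altitude (p ∷ʳ e) ≡ altitude p ℤ.+ Δy e
altitude-∷ʳ []      e = ℤ.+-comm (Δy e) (+ 0)
altitude-∷ʳ (d ∷ p) e = trans (cong (λ y → Δy d ℤ.+ y) (altitude-∷ʳ p e)) (sym (ℤ.+-assoc (Δy d) (altitude p) (Δy e)))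

last-∷ʳ : ∀ (p : Path) e → last (p ∷ʳ e) ≡ just e
last-∷ʳ []          e = refl
last-∷ʳ (_ ∷ [])    e = refl
last-∷ʳ (_ ∷ d ∷ p) e = last-∷ʳ (d ∷ p) e

inits-∷ʳ : ∀ (p : Path) e → inits (p ∷ʳ e) ≡ inits p ∷ʳ (p ∷ʳ e)
inits-∷ʳ []      e = refl
inits-∷ʳ (d ∷ p) e = cong ([] ∷_) (trans (cong (map (d ∷_)) (inits-∷ʳ p e)) (List.map-++ (d ∷_) (inits p) _))

self∈inits : ∀ (p : Path) → p ∈ inits p
self∈inits []      = here refl
self∈inits (d ∷ p) = there (∈-map⁺ (d ∷_) (self∈inits p))

stays-∷ʳ : ∀ b p e → StaysAbove b (p ∷ʳ e) ⇔ (StaysAbove b p × b ℤ.≤ altitude (p ∷ʳ e))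
stays-∷ʳ b p e = mk⇔
  (λ above → All.∷ʳ⁻ (subst (All _) (inits-∷ʳ p e) above))
  (λ { (above , b≤) → subst (All _) (sym (inits-∷ʳ p e)) (All.∷ʳ⁺ above b≤) })

linked-∷ʳ : {_~_ : Step → Step → Set} (p : Path) (e : Step) →
  Linked _~_ (p ∷ʳ e) ⇔ (Linked _~_ p × MaybeAll (_~ e) (last p))
linked-∷ʳ p e = mk⇔ (split p) λ { (linked , last~e) → join p linked last~e }
  where
  split : ∀ p → Linked _ (p ∷ʳ e) → Linked _ p × MaybeAll _ (last p)
  split []          [-]            = [] , nothing
  split (_ ∷ [])    (d~e ∷ [-])    = [-] , just d~e
  split (_ ∷ d ∷ p) (c~d ∷ linked) = let linked , last~e = split (d ∷ p) linked in c~d ∷ linked , last~e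

  join : ∀ p → Linked _ p → MaybeAll _ (last p) → Linked _ (p ∷ʳ e)
  join []          []             _          = [-]
  join (_ ∷ [])    [-]            (just d~e) = d~e ∷ [-]
  join (_ ∷ d ∷ p) (c~d ∷ linked) last~e     = c~d ∷ join (d ∷ p) linked last~e

opposite : Direction → Direction
opposite up   = down
opposite down = up

≢⇔opposite : ∀ c d → c ≢ d ⇔ c ≡ opposite d
≢⇔opposite up   up   = mk⇔ (λ c≢c → ⊥-elim (c≢c refl)) (λ ())
≢⇔opposite up   down = mk⇔ (λ _ → refl) (λ _ ())
≢⇔opposite down up   = mk⇔ (λ _ → refl) (λ _ ())
≢⇔opposite down down = mk⇔ (λ c≢c → ⊥-elim (c≢c refl)) (λ ())

short long : Direction → Step
short up   = N
short down = N̄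
long up    = E
long down  = Ē

short≢long : ∀ d → short d ≢ long d
short≢long up   ()
short≢long down ()

step-cases : ∀ e → e ≡ short (direction e) ⊎ e ≡ long (direction e)
step-cases N = inj₁ refl
step-cases N̄ = inj₁ refl
step-cases E = inj₂ refl
step-cases Ē = inj₂ refl

direction-short : ∀ d → direction (short d) ≡ d
direction-short up   = refl
direction-short down = refl

direction-long : ∀ d → direction (long d) ≡ d
direction-long up   = refl
direction-long down = refl

-- Paths are classified by the direction of the last step and by a condition A
-- on the altitude; the empty path is Weakly, not Strictly, of either direction.
module _ (m : ℕ) where
  private
    b : ℤ
    b = ℤ.- + m

  Ends : Pred ℤ 0ℓ → Pred Path 0ℓ
  Ends A p = Admissible m p × A (altitude p)

  Weakly Strictly : Direction → Pred ℤ 0ℓ → Pred Path 0ℓ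
  Weakly   d A p = Admissible m p × A (altitude p) × MaybeAll (λ e → direction e ≡ d) (last p)
  Strictly d A p = Admissible m p × A (altitude p) × MaybeAny (λ e → direction e ≡ d) (last p)

  module _ {A : Pred ℤ 0ℓ} (A? : Decidable A) where
    ends? : Decidable (Ends A)
    ends? p = admissible? m p ×-dec A? (altitude p)

    weakly? : ∀ d → Decidable (Weakly d A)
    weakly? d p = admissible? m p ×-dec A? (altitude p) ×-dec MaybeAll.dec (λ e → direction e ≟ᵈ d) (last p)

    strictly? : ∀ d → Decidable (Strictly d A)
    strictly? d p = admissible? m p ×-dec A? (altitude p) ×-dec MaybeAny.dec (λ e → direction e ≟ᵈ d) (last p)

  admissible-above : ∀ {p} → Admissible m p → b ℤ.≤ altitude p
  admissible-above {p} (_ , above) = All.lookup above (self∈inits p)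

  admissible-[] : Admissible m []
  admissible-[] = [] , (ℤ.neg-≤-pos ∷ [])

  admissible-∷ʳ : ∀ p e → Admissible m (p ∷ʳ e) ⇔
    ((Admissible m p × MaybeAll (λ d → direction d ≡ opposite (direction e)) (last p)) × b ℤ.≤ altitude p ℤ.+ Δy e)
  admissible-∷ʳ p e = mk⇔
    (λ { (zigzag , above) →
      let zigzag , last≢e = to (linked-∷ʳ p e) zigzag
          above , b≤      = to (stays-∷ʳ b p e) above
      in ((zigzag , above) , MaybeAll.map (λ {d} → to (≢⇔opposite (direction d) (direction e))) last≢e)
         , subst (b ℤ.≤_) (altitude-∷ʳ p e) b≤ })
    (λ { (((zigzag , above) , last≡) , b≤) →
        from (linked-∷ʳ p e) (zigzag , MaybeAll.map (λ {d} → from (≢⇔opposite (direction d) (direction e))) last≡)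
      , from (stays-∷ʳ b p e) (above , subst (b ℤ.≤_) (sym (altitude-∷ʳ p e)) b≤) })

  -- The requirement on the altitude prior to the step `e`: the new endpoint is the only point whose
  -- position relative to the line is still to be checked.
  before : Step → Pred ℤ 0ℓ → Pred ℤ 0ℓ
  before e A y = b ℤ.≤ y ℤ.+ Δy e × A (y ℤ.+ Δy e)

  before? : ∀ {A} → Decidable A → ∀ e → Decidable (before e A)
  before? A? e y = b ℤ.≤? y ℤ.+ Δy e ×-dec A? (y ℤ.+ Δy e)

  -- What remains ends in the opposite direction or is empty, since a first step may have either
  -- direction; hence `Weakly` on the right.
  strictly-∷ʳ : ∀ A p e → Strictly (direction e) A (p ∷ʳ e) ⇔ Weakly (opposite (direction e)) (before e A) p
  strictly-∷ʳ A p e = mk⇔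
    (λ { (adm , Ay , _) → let (adm , last≡) , b≤ = to (admissible-∷ʳ p e) adm in
      adm , (b≤ , subst A (altitude-∷ʳ p e) Ay) , last≡ })
    (λ { (adm , (b≤ , Ay) , last≡) →
      from (admissible-∷ʳ p e) ((adm , last≡) , b≤) , subst A (sym (altitude-∷ʳ p e)) Ay
      , subst (MaybeAny _) (sym (last-∷ʳ p e)) (just refl) })

  strictly-lastStep : ∀ d A p → Strictly d A p ⇔
    ((∃[ q ] p ≡ q ∷ʳ short d × Weakly (opposite d) (before (short d) A) q) ⊎
     (∃[ q ] p ≡ q ∷ʳ long d × Weakly (opposite d) (before (long d) A) q))
  strictly-lastStep d A p = mk⇔ split
    [ (λ { (q , refl , weakly) → append q (short d) (direction-short d) weakly })
    , (λ { (q , refl , weakly) → append q (long d) (direction-long d) weakly }) ]′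
    where
    append : ∀ q e → direction e ≡ d → Weakly (opposite d) (before e A) q → Strictly d A (q ∷ʳ e)
    append q e refl = from (strictly-∷ʳ A q e)

    split : Strictly d A p → _
    split strictly with initLast p
    split (_ , _ , ()) | []
    split strictly@(_ , _ , last≡) | q ∷ʳ′ e with MaybeAny.drop-just (subst (MaybeAny _) (last-∷ʳ q e) last≡)
    ... | refl with step-cases e
    ...   | inj₁ e≡ = inj₁ (q , cong (q ∷ʳ_) e≡ , subst (λ e′ → Weakly (opposite (direction e)) (before e′ A) q) e≡ (to (strictly-∷ʳ A q e) strictly))
    ...   | inj₂ e≡ = inj₂ (q , cong (q ∷ʳ_) e≡ , subst (λ e′ → Weakly (opposite (direction e)) (before e′ A) q) e≡ (to (strictly-∷ʳ A q e) strictly))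

-- Generating functions

private
  module ℚ[z] = PowerSeriesRing ℚ.+-*-commutativeRing
  module Z where
    open CommutativeRing ℚ[z].commutativeRing public
    open RingNotation rawRing public using (_^_)

-- The operation `ℚ./` normalises by a gcd that does not compute for variables, so the sum is
-- compared among unnormalised fractions.
fromℕ-+ : ∀ a b → + (a ℕ.+ b) ℚ./ 1 ≡ + a ℚ./ 1 ℚ.+ + b ℚ./ 1
fromℕ-+ a b = ℚ.toℚᵘ-injective (begin
  ℚ.toℚᵘ (+ (a ℕ.+ b) ℚ./ 1)                    ≈⟨ ℚ.toℚᵘ-fromℚᵘ (ℚᵘ.mkℚᵘ (+ (a ℕ.+ b)) 0) ⟩
  ℚᵘ.mkℚᵘ (+ (a ℕ.+ b)) 0                        ≈⟨ ℚᵘ.*≡* (cong (ℤ._* + 1) (sym (cong₂ ℤ._+_ (ℤ.*-identityʳ (+ a)) (ℤ.*-identityʳ (+ b))))) ⟩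
  ℚᵘ.mkℚᵘ (+ a) 0 ℚᵘ.+ ℚᵘ.mkℚᵘ (+ b) 0            ≈⟨ ℚᵘ.+-cong (ℚ.toℚᵘ-fromℚᵘ (ℚᵘ.mkℚᵘ (+ a) 0)) (ℚ.toℚᵘ-fromℚᵘ (ℚᵘ.mkℚᵘ (+ b) 0)) ⟨
  ℚ.toℚᵘ (+ a ℚ./ 1) ℚᵘ.+ ℚ.toℚᵘ (+ b ℚ./ 1)      ≈⟨ ℚ.toℚᵘ-homo-+ (+ a ℚ./ 1) (+ b ℚ./ 1) ⟨
  ℚ.toℚᵘ (+ a ℚ./ 1 ℚ.+ + b ℚ./ 1)               ∎)
  where open import Relation.Binary.Reasoning.Setoid ℚᵘ.≃-setoid

gf-cong : (P? : Decidable P) (Q? : Decidable Q) → (∀ p → P p ⇔ Q p) →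
  generatingFunction P? Z.≈ generatingFunction Q?
gf-cong P? Q? P⇔Q n = cong (λ k → + k ℚ./ 1) (count-cong P? Q? n λ p _ → P⇔Q p)

gf-∅ : (P? : Decidable P) → (∀ p → ¬ P p) → generatingFunction P? Z.≈ Z.0#
gf-∅ P? ¬P zero    = cong (λ k → + k ℚ./ 1) (count-∅ P? 0 ¬P)
gf-∅ P? ¬P (suc n) = cong (λ k → + k ℚ./ 1) (count-∅ P? (suc n) ¬P)

gf-⊎ : (P? : Decidable P) (Q? : Decidable Q) (R? : Decidable R) →
  (∀ p → P p ⇔ (Q p ⊎ R p)) → (∀ p → ¬ (Q p × R p)) →
  generatingFunction P? Z.≈ generatingFunction Q? Z.+ generatingFunction R?
gf-⊎ P? Q? R? P⇔Q⊎R disjoint n =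
  trans (cong (λ k → + k ℚ./ 1) (count-⊎ P? Q? R? n P⇔Q⊎R disjoint)) (fromℕ-+ (count Q? n) (count R? n))

empty? : Decidable {A = Path} (_≡ [])
empty? []      = yes refl
empty? (_ ∷ _) = no λ ()

gf-empty : generatingFunction empty? Z.≈ Z.1#
gf-empty zero    = refl
gf-empty (suc n) = cong (λ k → + k ℚ./ 1) (count-enumeration empty? (suc n) {[]} [] λ p → mk⇔ (λ ()) λ { (() , refl) })

gf-before : (P? : Decidable P) (d n : ℕ) →
  + countBefore d P? n ℚ./ 1 ≡ ((X Z.^ d) Z.* generatingFunction P?) n
gf-before P? zero    n       = sym (ℚ[z].*-identityˡ-≈ (generatingFunction P?) n)
gf-before P? (suc d) zero    = sym (trans (ℚ[z].*-assoc-≈ X (X Z.^ d) (generatingFunction P?) 0) (ℚ[z].X*-zero ((X Z.^ d) Z.* generatingFunction P?)))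
gf-before P? (suc d) (suc n) = trans (gf-before P? d n)
  (sym (trans (ℚ[z].*-assoc-≈ X (X Z.^ d) (generatingFunction P?) (suc n)) (ℚ[z].X*-suc ((X Z.^ d) Z.* generatingFunction P?) n)))

gf-lastStep : (P? : Decidable P) (Q? : Decidable Q) (R? : Decidable R) (d e : Step) → d ≢ e →
  (∀ p → P p ⇔ ((∃[ q ] p ≡ q ∷ʳ d × Q q) ⊎ (∃[ q ] p ≡ q ∷ʳ e × R q))) →
  generatingFunction P? Z.≈ (X Z.^ Δx d) Z.* generatingFunction Q? Z.+ (X Z.^ Δx e) Z.* generatingFunction R?
gf-lastStep P? Q? R? d e d≢e decompose n =
  trans (cong (λ k → + k ℚ./ 1) (count-lastStep P? Q? R? d e d≢e n decompose))
    (trans (fromℕ-+ (countBefore (Δx d) Q? n) (countBefore (Δx e) R? n))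
      (cong₂ ℚ._+_ (gf-before Q? (Δx d) n) (gf-before R? (Δx e) n)))

last-any : {Q : Pred Step 0ℓ} (p : Path) → MaybeAll Q (last p) ⇔ (MaybeAny Q (last p) ⊎ p ≡ [])
last-any []          = mk⇔ (λ _ → inj₂ refl) λ _ → nothing
last-any (e ∷ [])    = mk⇔ (λ { (just Qe) → inj₁ (just Qe) }) λ { (inj₁ (just Qe)) → just Qe }
last-any (_ ∷ e ∷ p) = mk⇔
  ([ inj₁ , (λ ()) ]′ ∘ to (last-any (e ∷ p)))
  ([ from (last-any (e ∷ p)) ∘ inj₁ , (λ ()) ]′)

-- Recurrences in the height above the line

module Recurrences (m : ℕ) where
  open import Algebra.Properties.Group (AbelianGroup.group ℤ.+-0-abelianGroup)
    using (∙-cancelˡ; //-rightDividesˡ; //-rightDividesʳ)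
  private
    b : ℤ
    b = ℤ.- + m

  level : ℕ → ℤ
  level k = b ℤ.+ + k

  At : ℕ → Pred ℤ 0ℓ
  At k y = y ≡ level k

  at? : ∀ k → Decidable (At k)
  at? k y = y ℤ.≟ level k

  Any : Pred ℤ 0ℓ
  Any _ = ⊤

  any? : Decidable Any
  any? _ = yes tt

  -- Under `at? k`, `W up` and `S down` unfold to the coefficients of `F m` and `G m`. `S up` and
  -- `W down` are their variants without and with the empty path, as each recurrence refers to a
  -- possibly empty remainder.
  W S : Direction → {A : Pred ℤ 0ℓ} → Decidable A → Series
  W d A? = generatingFunction (weakly? m A? d)
  S d A? = generatingFunction (strictly? m A? d)

  level-injective : ∀ {j k} → level j ≡ level k → j ≡ k
  level-injective eq = ℤ.+-injective (∙-cancelˡ b _ _ eq)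

  level-rise : ∀ j d → level j ℤ.+ + d ≡ level (d ℕ.+ j)
  level-rise j d = trans (ℤ.+-assoc b (+ j) (+ d)) (cong (λ i → b ℤ.+ + i) (ℕ.+-comm j d))

  level-fall : ∀ j d → level (d ℕ.+ j) ℤ.+ ℤ.- + d ≡ level j
  level-fall j d = trans (cong (λ i → i ℤ.+ ℤ.- + d) (sym (level-rise j d))) (//-rightDividesʳ (+ d) (level j))

  b≤level : ∀ k → b ℤ.≤ level k
  b≤level k = ℤ.i≤i+j b (+ k)

  height : ∀ {y} → b ℤ.≤ y → ∃[ k ] y ≡ level k
  height {y} b≤y = ℤ.∣ y ℤ.- b ∣ , sym (trans (cong (λ i → b ℤ.+ i) (ℤ.0≤i⇒+∣i∣≡i (ℤ.i≤j⇒0≤j-i b≤y)))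
    (trans (ℤ.+-comm b (y ℤ.- b)) (//-rightDividesˡ b y)))

  private
    -- An admissible path never ends below the line, so its altitude is some `level k`; conditions
    -- on altitudes need comparing at natural heights only.
    atLevel : ∀ {A B : Pred ℤ 0ℓ} → (∀ k → A (level k) → B (level k)) → ∀ {p} → Admissible m p → A (altitude p) → B (altitude p)
    atLevel {A} {B} A⇒B {p} adm Ay with k , y≡ ← height (admissible-above m {p} adm) =
      subst B (sym y≡) (A⇒B k (subst A y≡ Ay))

  module _ {A : Pred ℤ 0ℓ} (A? : Decidable A) where
    W-cong : ∀ {B} (B? : Decidable B) d → (∀ k → A (level k) ⇔ B (level k)) → W d A? Z.≈ W d B?
    W-cong {B} B? d A⇔B = gf-cong (weakly? m A? d) (weakly? m B? d) λ p → mk⇔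
      (λ { (adm , Ay , last≡) → adm , atLevel {A} {B} (to ∘ A⇔B) {p} adm Ay , last≡ })
      (λ { (adm , By , last≡) → adm , atLevel {B} {A} (from ∘ A⇔B) {p} adm By , last≡ })

    W-∅ : ∀ d → (∀ k → ¬ A (level k)) → W d A? Z.≈ Z.0#
    W-∅ d ¬A = gf-∅ (weakly? m A? d) λ { p (adm , Ay , _) →
      atLevel {A} {λ _ → _} ¬A {p} adm Ay }

    W-⊎ : ∀ {B C} (B? : Decidable B) (C? : Decidable C) d →
      (∀ k → A (level k) ⇔ (B (level k) ⊎ C (level k))) → (∀ k → ¬ (B (level k) × C (level k))) →
      W d A? Z.≈ W d B? Z.+ W d C?
    W-⊎ {B} {C} B? C? d A⇔B⊎C disjoint = gf-⊎ (weakly? m A? d) (weakly? m B? d) (weakly? m C? d)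
      (λ p → mk⇔
        (λ { (adm , Ay , last≡) → [ (λ By → inj₁ (adm , By , last≡)) , (λ Cy → inj₂ (adm , Cy , last≡)) ]′
               (atLevel {A} {λ y → B y ⊎ C y} (to ∘ A⇔B⊎C) {p} adm Ay) })
        [ (λ { (adm , By , last≡) → adm , atLevel {B} {A} (λ k → from (A⇔B⊎C k) ∘ inj₁) {p} adm By , last≡ })
        , (λ { (adm , Cy , last≡) → adm , atLevel {C} {A} (λ k → from (A⇔B⊎C k) ∘ inj₂) {p} adm Cy , last≡ }) ]′)
      λ { p ((adm , By , _) , (_ , Cy , _)) → atLevel {λ y → B y × C y} {λ _ → _} disjoint {p} adm (By , Cy) }

    W-strict : ∀ d → ¬ A (+ 0) → W d A? Z.≈ S d A?
    W-strict d ¬A = gf-cong (weakly? m A? d) (strictly? m A? d) λ p → mk⇔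
      (λ { (adm , Ay , last≡) → adm , Ay , [ id , (λ { refl → ⊥-elim (¬A Ay) }) ]′ (to (last-any p) last≡) })
      (λ { (adm , Ay , last≡) → adm , Ay , from (last-any p) (inj₁ last≡) })

    W-empty : ∀ d → A (+ 0) → W d A? Z.≈ S d A? Z.+ Z.1#
    W-empty d A₀ n = trans (gf-⊎ (weakly? m A? d) (strictly? m A? d) empty?
      (λ p → mk⇔
        (λ { (adm , Ay , last≡) → [ (λ last≡ → inj₁ (adm , Ay , last≡)) , inj₂ ]′ (to (last-any p) last≡) })
        [ (λ { (adm , Ay , last≡) → adm , Ay , from (last-any p) (inj₁ last≡) })
        , (λ { refl → admissible-[] m , A₀ , nothing }) ]′)
      (λ { p ((_ , _ , ()) , refl) }) n) (cong (S d A? n ℚ.+_) (gf-empty n))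

    S-lastStep : ∀ d → S d A? Z.≈
      (X Z.^ Δx (short d)) Z.* W (opposite d) (before? m A? (short d)) Z.+
      (X Z.^ Δx (long d)) Z.* W (opposite d) (before? m A? (long d))
    S-lastStep d = gf-lastStep (strictly? m A? d) (weakly? m (before? m A? (short d)) (opposite d))
      (weakly? m (before? m A? (long d)) (opposite d)) (short d) (long d) (short≢long d) (strictly-lastStep m d A)

  fall-bound : ∀ d e k → Δy e ≡ ℤ.- + d → b ℤ.≤ level k ℤ.+ Δy e → d ≤ k
  fall-bound d e k Δy≡-d b≤ with j , eq ← height b≤ = subst (d ≤_) (sym (level-injective
    (trans (sym (//-rightDividesˡ (+ d) (level k)))
      (trans (cong (ℤ._+ + d) (trans (cong (λ i → level k ℤ.+ i) (sym Δy≡-d)) eq)) (level-rise j d))))) (ℕ.m≤m+n d j)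

  private
    z z² : Series → Series
    z  f = (X Z.^ 1) Z.* f
    z² f = (X Z.^ 2) Z.* f

  W-at-zero : ∀ d → W d (at? m) Z.≈ S d (at? m) Z.+ Z.1#
  W-at-zero d = W-empty (at? m) d (sym (ℤ.+-inverseˡ (+ m)))

  W-at-nonzero : ∀ d {k} → k ≢ m → W d (at? k) Z.≈ S d (at? k)
  W-at-nonzero d {k} k≢m = W-strict (at? k) d λ 0≡ → k≢m (level-injective (trans (sym 0≡) (sym (ℤ.+-inverseˡ (+ m)))))

  W-up-at : ∀ d e k → Δy e ≡ + d → W down (before? m (at? (d ℕ.+ k)) e) Z.≈ W down (at? k)
  W-up-at d e k Δy≡d = W-cong (before? m (at? (d ℕ.+ k)) e) (at? k) down λ j → mk⇔
    (λ { (_ , eq) → cong level (ℕ.+-cancelˡ-≡ d j k (level-injective (trans (sym (rise j)) eq))) })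
    (λ eq → subst (b ℤ.≤_) (sym (rise j)) (b≤level (d ℕ.+ j)) , trans (rise j) (cong (λ i → level (d ℕ.+ i)) (level-injective eq)))
    where
    rise : ∀ j → level j ℤ.+ Δy e ≡ level (d ℕ.+ j)
    rise j = trans (cong (λ i → level j ℤ.+ i) Δy≡d) (level-rise j d)

  -- A rise by `d` that ends at a height below `d` would have to start below the line.
  W-up-below : ∀ d e k → k ℕ.< d → Δy e ≡ + d → W down (before? m (at? k) e) Z.≈ Z.0#
  W-up-below d e k k<d Δy≡d = W-∅ (before? m (at? k) e) down λ { j (_ , eq) →
    ℕ.<⇒≱ k<d (subst (d ≤_) (level-injective (trans (sym (trans (cong (λ i → level j ℤ.+ i) Δy≡d) (level-rise j d))) eq)) (ℕ.m≤m+n d j)) }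

  W-down-at : ∀ d e k → Δy e ≡ ℤ.- + d → W up (before? m (at? k) e) Z.≈ W up (at? (d ℕ.+ k))
  W-down-at d e k Δy≡-d = W-cong (before? m (at? k) e) (at? (d ℕ.+ k)) up λ j → mk⇔
    (λ { (_ , eq) → trans (sym (//-rightDividesˡ (+ d) (level j)))
                      (trans (cong (ℤ._+ + d) (trans (cong (λ i → level j ℤ.+ i) (sym Δy≡-d)) eq)) (level-rise k d)) })
    (λ eq → let fall = trans (cong (λ i → i ℤ.+ Δy e) eq) (trans (cong (λ i → level (d ℕ.+ k) ℤ.+ i) Δy≡-d) (level-fall k d))
            in subst (b ℤ.≤_) (sym fall) (b≤level k) , fall)

  S-up-zero : S up (at? 0) Z.≈ Z.0#
  S-up-zero = Z.trans (S-lastStep (at? 0) up) (Z.trans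
    (Z.+-cong (Z.*-congˡ {X Z.^ 1} (W-up-below 2 N 0 (ℕ.s≤s ℕ.z≤n) refl)) (Z.*-congˡ {X Z.^ 2} (W-up-below 1 E 0 (ℕ.s≤s ℕ.z≤n) refl)))
    (Z.trans (Z.+-cong (Z.zeroʳ (X Z.^ 1)) (Z.zeroʳ (X Z.^ 2))) (Z.+-identityˡ Z.0#)))

  S-up-one : S up (at? 1) Z.≈ z² (W down (at? 0))
  S-up-one = Z.trans (S-lastStep (at? 1) up) (Z.trans
    (Z.+-cong (Z.*-congˡ {X Z.^ 1} (W-up-below 2 N 1 (ℕ.s≤s (ℕ.s≤s ℕ.z≤n)) refl)) (Z.*-congˡ {X Z.^ 2} (W-up-at 1 E 0 refl)))
    (Z.trans (Z.+-congʳ {z² (W down (at? 0))} (Z.zeroʳ (X Z.^ 1))) (Z.+-identityˡ (z² (W down (at? 0))))))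

  S-up-suc : ∀ k → S up (at? (2 ℕ.+ k)) Z.≈ z (W down (at? k)) Z.+ z² (W down (at? (1 ℕ.+ k)))
  S-up-suc k = Z.trans (S-lastStep (at? (2 ℕ.+ k)) up)
    (Z.+-cong (Z.*-congˡ {X Z.^ 1} (W-up-at 2 N k refl)) (Z.*-congˡ {X Z.^ 2} (W-up-at 1 E (1 ℕ.+ k) refl)))

  S-down : ∀ k → S down (at? k) Z.≈ z (W up (at? (2 ℕ.+ k))) Z.+ z² (W up (at? (1 ℕ.+ k)))
  S-down k = Z.trans (S-lastStep (at? k) down)
    (Z.+-cong (Z.*-congˡ {X Z.^ 1} (W-down-at 2 N̄ k refl)) (Z.*-congˡ {X Z.^ 2} (W-down-at 1 Ē k refl)))

  S-up-any : S up any? Z.≈ z (W down any?) Z.+ z² (W down any?)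
  S-up-any = Z.trans (S-lastStep any? up)
    (Z.+-cong (Z.*-congˡ {X Z.^ 1} (always 2 N refl)) (Z.*-congˡ {X Z.^ 2} (always 1 E refl)))
    where
    always : ∀ d e → Δy e ≡ + d → W down (before? m any? e) Z.≈ W down any?
    always d e Δy≡d = W-cong (before? m any? e) any? down λ j → mk⇔ (λ _ → tt) λ _ →
      subst (b ℤ.≤_) (sym (trans (cong (λ i → level j ℤ.+ i) Δy≡d) (level-rise j d))) (b≤level (d ℕ.+ j)) , tt

  S-down-any : S down any? Z.≈ z (W up (before? m any? N̄)) Z.+ z² (W up (before? m any? Ē))
  S-down-any = S-lastStep any? down

  -- The step Ē is blocked exactly at height 0, and N̄ in the next lemma at heights 0 and 1. The
  -- blocked paths give the boundary terms f₋ₘ and f₋ₘ₊₁ of the equation for the total.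
  W-up-Ē : W up any? Z.≈ W up (before? m any? Ē) Z.+ W up (at? 0)
  W-up-Ē = W-⊎ any? (before? m any? Ē) (at? 0) up
    (λ { zero    → mk⇔ (λ _ → inj₂ refl) (λ _ → tt)
       ; (suc k) → mk⇔ (λ _ → inj₁ (subst (b ℤ.≤_) (sym (level-fall k 1)) (b≤level k) , tt)) (λ _ → tt) })
    (λ { k ((b≤ , _) , eq) → ℕ.<⇒≢ (fall-bound 1 Ē k refl b≤) (sym (level-injective eq)) })

  W-up-N̄ : W up any? Z.≈ W up (before? m any? N̄) Z.+ (W up (at? 1) Z.+ W up (at? 0))
  W-up-N̄ = Z.trans
    (W-⊎ any? (before? m any? N̄) (λ y → at? 1 y ⊎-dec at? 0 y) up
      (λ { zero          → mk⇔ (λ _ → inj₂ (inj₂ refl)) (λ _ → tt)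
         ; (suc zero)    → mk⇔ (λ _ → inj₂ (inj₁ refl)) (λ _ → tt)
         ; (suc (suc k)) → mk⇔ (λ _ → inj₁ (subst (b ℤ.≤_) (sym (level-fall k 2)) (b≤level k) , tt)) (λ _ → tt) })
      (λ { k ((b≤ , _) , low) → ℕ.<⇒≱ (fall-bound 2 N̄ k refl b≤)
             ([ ℕ.≤-reflexive ∘ level-injective , (λ eq → ℕ.≤-trans (ℕ.≤-reflexive (level-injective eq)) ℕ.z≤n) ]′ low) }))
    (Z.+-congˡ {W up (before? m any? N̄)}
      (W-⊎ (λ y → at? 1 y ⊎-dec at? 0 y) (at? 1) (at? 0) up (λ k → mk⇔ id id)
        (λ k (eq , eq′) → 1≢0 (level-injective (trans (sym eq) eq′)))))
    where
    1≢0 : 1 ≢ 0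
    1≢0 ()

  ends-split : {A : Pred ℤ 0ℓ} (A? : Decidable A) → generatingFunction (ends? m A?) Z.≈ W up A? Z.+ S down A?
  ends-split A? = gf-⊎ (ends? m A?) (weakly? m A? up) (strictly? m A? down)
    (λ p → mk⇔
      (λ { (adm , Ay) → [ (λ last≡ → inj₁ (adm , Ay , last≡)) , (λ last≡ → inj₂ (adm , Ay , last≡)) ]′ (cases (last p)) })
      [ (λ { (adm , Ay , _) → adm , Ay }) , (λ { (adm , Ay , _) → adm , Ay }) ]′)
    λ { p ((_ , _ , last≡up) , (_ , _ , last≡down)) → disjoint last≡up last≡down }
    where
    cases : ∀ e → MaybeAll (λ e → direction e ≡ up) e ⊎ MaybeAny (λ e → direction e ≡ down) e
    cases nothing  = inj₁ nothing
    cases (just N) = inj₁ (just refl)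
    cases (just E) = inj₁ (just refl)
    cases (just N̄) = inj₂ (just refl)
    cases (just Ē) = inj₂ (just refl)

    disjoint : ∀ {e} → MaybeAll (λ e → direction e ≡ up) e → ¬ MaybeAny (λ e → direction e ≡ down) e
    disjoint (just eq) (just eq′) with () ← trans (sym eq) eq′

  total-ends : total m Z.≈ generatingFunction (ends? m any?)
  total-ends = gf-cong (admissible? m) (ends? m any?) λ p → mk⇔ (_, tt) proj₁

  below? : ∀ K → Decidable (ℤ._< level K)
  below? K y = y ℤ.<? level K

  -- A partial sum over heights counts the paths ending below `level K`. Induction adds the topmost
  -- height, whereas `sum` unfolds from the lowest; `sum-suc` reconciles the two.
  sum-H : ∀ K n → RingNotation.sum ℚ-ring {K} (λ k → H m (toℕ k) n) ≡ generatingFunction (ends? m (below? K)) n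
  sum-H zero    n = sym (cong (λ k → + k ℚ./ 1) (count-∅ (ends? m (below? 0)) n λ { p (adm , y<) →
    ℤ.<⇒≱ y< (subst (ℤ._≤ altitude p) (sym (ℤ.+-identityʳ b)) (admissible-above m {p} adm)) }))
  sum-H (suc K) n = trans (sum-suc (λ k → H m k n) K) (trans (cong₂ ℚ._+_ (sum-H K n) (sym (ends-split (at? K) n)))
    (sym (gf-⊎ (ends? m (below? (suc K))) (ends? m (below? K)) (ends? m (at? K))
      (λ p → mk⇔
        (λ { (adm , y<) → [ (λ y<′ → inj₁ (adm , y<′)) , (λ y≡ → inj₂ (adm , y≡)) ]′ (split y<) })
        [ (λ { (adm , y<) → adm , ℤ.<-trans y< level< }) , (λ { (adm , y≡) → adm , subst (ℤ._< level (suc K)) (sym y≡) level< }) ]′)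
      (λ { p ((_ , y<) , (_ , y≡)) → ℤ.<-irrefl y≡ y< }) n)))
    where
    sum-suc : ∀ (h : ℕ → ℚ) K →
      RingNotation.sum ℚ-ring {suc K} (λ k → h (toℕ k)) ≡ RingNotation.sum ℚ-ring {K} (λ k → h (toℕ k)) ℚ.+ h K
    sum-suc h zero    = ℚ.+-comm (h 0) 0ℚ
    sum-suc h (suc K) = trans (cong (h 0 ℚ.+_) (sum-suc (h ∘ suc) K)) (sym (ℚ.+-assoc (h 0) _ _))

    level< : level K ℤ.< level (suc K)
    level< = ℤ.+-monoʳ-< b (ℤ.+<+ ℕ.≤-refl)

    split : ∀ {y} → y ℤ.< level (suc K) → y ℤ.< level K ⊎ y ≡ level K
    split {y} y< with ℤ.<-cmp y (level K)
    ... | tri< y<K _ _ = inj₁ y<K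
    ... | tri≈ _ y≡K _ = inj₂ y≡K
    ... | tri> _ _ K<y = ⊥-elim (ℤ.<⇒≱ y< (subst (ℤ._≤ y) (trans (sym (ℤ.+-assoc (+ 1) b (+ K)))
            (trans (cong (ℤ._+ + K) (ℤ.+-comm (+ 1) b)) (ℤ.+-assoc b (+ 1) (+ K)))) (ℤ.i<j⇒suc[i]≤j K<y)))

  -- No step rises by more than twice its width, with equality for N. At a fixed size only finitely
  -- many heights occur, which makes the value at u = 1 meaningful.
  altitude-bound : ∀ p → altitude p ℤ.≤ + (2 ℕ.* size p)
  altitude-bound []      = ℤ.≤-refl
  altitude-bound (e ∷ p) = subst (λ n → altitude (e ∷ p) ℤ.≤ + n) (sym (ℕ.*-distribˡ-+ 2 (Δx e) (size p)))
    (ℤ.+-mono-≤ (bound e) (altitude-bound p))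
    where
    bound : ∀ e → Δy e ℤ.≤ + (2 ℕ.* Δx e)
    bound N = ℤ.≤-refl
    bound N̄ = ℤ.-≤+
    bound E = ℤ.+≤+ (ℕ.s≤s ℕ.z≤n)
    bound Ē = ℤ.-≤+

  H-at-one : ValueAtOne (H m) (total m)
  -- The altitude is at most 2n, which is height m + 2n above the line; one more height makes the
  -- bound strict.
  H-at-one n = suc (m ℕ.+ 2 ℕ.* n) , λ K large → trans (sum-H K n)
    (cong (λ k → + k ℚ./ 1) (count-cong (ends? m (below? K)) (admissible? m) n λ { p refl → mk⇔ proj₁ λ adm → adm ,
      ℤ.≤-<-trans (altitude-bound p) (subst (ℤ._< level K) (trans (sym (ℤ.+-assoc b (+ m) (+ (2 ℕ.* n))))
        (trans (cong (ℤ._+ + (2 ℕ.* n)) (ℤ.+-inverseˡ (+ m))) (ℤ.+-identityˡ (+ (2 ℕ.* n)))))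
        (ℤ.+-monoʳ-< b (ℤ.+<+ large))) }))

-- Specialisation to rational coefficients

½+½≈1 : const ½ Z.+ const ½ Z.≈ Z.1#
½+½≈1 zero    = refl
½+½≈1 (suc n) = refl

ν₊ : Z.Carrier
ν₊ = Solution.ν₊ ℚ.+-*-commutativeRing (const ½) (√ Roots.Δ) ½+½≈1 (√-square Roots.Δ refl)

ν₊-inverse : ∃[ w ] ν₊ Z.* w Z.≈ Z.1#
-- The chosen branch of the square root has constant term 1, so that of `ν₊` evaluates to ½ (1 + 1)
-- = 1. With the other branch it would be 0.
ν₊-inverse = ℚ[z].inverse ν₊ 1ℚ refl

module _ (n : ℕ) where
  open Recurrences (suc n)

  total-equation : KernelAlgebra.TotalEquation ℚ[z].commutativeRing X (f (suc n) 1) (total (suc n))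
  total-equation = KernelAlgebra.totalEquation ℚ[z].commutativeRing X (f (suc n) 1) (f (suc n) 0) (total (suc n))
    (W up any?) (S up any?) (S down any?) (W down any?) (W up (before? (suc n) any? N̄)) (W up (before? (suc n) any? Ē))
    (Z.trans total-ends (ends-split any?)) (W-empty any? up _) (W-empty any? down _)
    -- Positivity of m enters here as 0 ≢ `suc n`: the empty path does not lie on the line, and no
    -- up-step ends there, so f₋ₘ = 0.
    S-up-any S-down-any W-up-N̄ W-up-Ē (Z.trans (W-at-nonzero up {0} λ ()) S-up-zero)

  private
    module Solved = Solution.Paths ℚ.+-*-commutativeRing (const ½) (√ Roots.Δ) ½+½≈1 (√-square Roots.Δ refl)
      (proj₁ ν₊-inverse) (proj₂ ν₊-inverse) n
      (λ k → W up (at? k)) (λ k → S up (at? k)) (λ k → W down (at? k)) (λ k → S down (at? k)) (total (suc n))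
      (W-at-zero up) (λ {k} → W-at-nonzero up {k}) (W-at-zero down) (λ {k} → W-at-nonzero down {k})
      S-up-zero S-up-one S-up-suc S-down total-equation

  closedForms : ClosedForms Bivariate._≈_÷_ Bivariate._+_ Bivariate._*_ Bivariate._-_ (Bivariate.-_) Bivariate._^_ Bivariate.1#
    Bivariate.u Bivariate.z Bivariate.r Bivariate.s (embed (F (suc n))) (embed (G (suc n))) (suc n)
  closedForms = Solved.closedForms

  totalClosedForm : TotalClosedForm Univariate._≈_÷_ Univariate._+_ Univariate._*_ Univariate._-_ (Univariate.-_) Univariate._^_ Univariate.1#
    Univariate.z Univariate.r (fromSeries (total (suc n))) (suc n)
  totalClosedForm = Solved.totalClosedForm

theorem4p1 : (m : ℕ) → 1 ≤ m →
    (let open Bivariate in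
    embed (F m)
    ≈ - (u * (u ^ m * (1# + z ^ 2 * u + z * u ^ 2)
    - r ^ (m ∸ 1) * z * (u + z) * (z + r * z ^ 2 + r ^ 2)))
    ÷ (z ^ 3 * (u - r) * (u - s)))
    × (let open Bivariate in
    embed (G m)
    ≈ (r ^ (m ∸ 1) * (z + r ^ 2 + z ^ 2 * r)
    - z * u ^ (m ∸ 1) * (1# + z * u) * (1# + z ^ 2 * u + z * u ^ 2))
    ÷ (z ^ 3 * (u - r) * (u - s)))
    × ValueAtOne (H m) (total m)
    × (let open Univariate in
    fromSeries (total m)
    ≈ (z * r ^ (m ∸ 1) + z ^ 2 * r ^ m + r ^ suc m - z ^ 2 - z - 1#)
    ÷ (z ^ 2 + z - 1#))
theorem4p1 (suc n) _ =
    ClosedForms.F-closed (closedForms n)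
  , ClosedForms.G-closed (closedForms n)
  , Recurrences.H-at-one (suc n)
  , TotalClosedForm.closed (totalClosedForm n)
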